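{- Let $\Delta\ne0$ be an integer. Then $$\sum_{\substack{r_1\ge1\\ (r_1,\Delta)=1}}\ \sum_{\substack{r_2\ge1\\ (r_2,\Delta)=1}}\ \sum_{\substack{d_1\ge1\\ q\mid d_1\Rightarrow q\mid\Delta}}\ \sum_{\substack{d_2\ge1\\ q\mid d_2\Rightarrow q\mid\Delta}}\frac{\prod_{\substack{q\mid r_1r_2\\ q>3}}\left(1-\frac3q\right)^{ -1}}{[r_1^2d_1,r_2^2d_2]}\ll1,$$ i.e. this series of positive terms converges, with sum bounded by a constant depending only on $\Delta$.
   Context: $r_1,r_2,d_1,d_2$ run over positive integers; $q$ denotes primes, so "$q\mid d\Rightarrow q\mid\Delta$" means every prime factor of $d$ divides $\Delta$. $(\cdot,\cdot)$ is the gcd and $[\cdot,\cdot]$ the lcm. -}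

module Defs where

open import Data.Integer.Base as ℤ using (ℤ; +_; 1ℤ)
open import Data.Integer.Divisibility as ℤ using ()
open import Data.Integer.GCD as ℤ using ()
open import Data.List.Base using (List; filter; foldr; map; upTo)
open import Data.List.Relation.Binary.Subset.Propositional using (_⊆_)
open import Data.List.Relation.Unary.All using (All)
open import Data.List.Relation.Unary.Unique.Propositional using (Unique)
open import Data.Nat.Base as ℕ using (ℕ; suc)
open import Data.Nat.Divisibility as ℕ using (_∣?_)
open import Data.Nat.LCM as ℕ using ()
open import Data.Nat.Primality using (Prime; prime?)
open import Data.Nat.Properties as ℕ using ()
open import Data.Product.Base using (_×_; _,_; ∃-syntax)
open import Data.Rational.Base
open import Data.Rational.Properties using (_≟_)
open import Relation.Binary.PropositionalEquality.Core using (_≡_)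
open import Relation.Nullary.Decidable.Core using (yes; no; _×-dec_)

-- Real numbers, as regular Cauchy sequences of rationals: `approx n` is
-- within 1/(n+1) of the number represented.

record ℝ : Set where
  field
    approx  : ℕ → ℚ
    regular : ∀ m n →
      ∣ approx m - approx n ∣ ≤ (+ 1 / suc m) + (+ 1 / suc n)

open ℝ public

_≤ᴿ_ : ℝ → ℚ → Set
x ≤ᴿ c = ∀ n → approx x n ≤ c + (+ 1 / suc n)

-- |p - x| ≤ ε for a rational p and a real x.
Within : ℚ → ℚ → ℝ → Set
Within ε p x = ∀ n → ∣ p - approx x n ∣ ≤ ε + (+ 1 / suc n)

-- Unordered summation over the i satisfying P.  For nonnegative terms this
-- has the same meaning as iterated summation in any order.

record FiniteSubset {I : Set} (P : I → Set) (is : List I) : Set where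
  field
    members  : All P is
    distinct : Unique is

sum : {I : Set} → (I → ℚ) → List I → ℚ
sum a is = foldr _+_ 0ℚ (map a is)

HasSum : {I : Set} → (I → Set) → (I → ℚ) → ℝ → Set
HasSum P a x =
  ∀ ε → 0ℚ < ε →
  ∃[ is₀ ] FiniteSubset P is₀ ×
    (∀ is → FiniteSubset P is → is₀ ⊆ is → Within ε (sum a is) x)

-- Total inversion with 0 ⁻¹ = 0.  It is only applied below to nonzero
-- numbers: to lcms of positive integers, to primes q, and to 1 - 3/q for q > 3.
infix 8 _⁻¹

_⁻¹ : ℚ → ℚ
p ⁻¹ with p ≟ 0ℚ
... | yes _   = 0ℚ
... | no  p≢0 = (1/ p) {{≢-nonZero p≢0}}

fromℕ : ℕ → ℚ
fromℕ n = + n / 1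

-- The primes q > 3 dividing n, each listed once; correct for n ≥ 1.
primeDivisors>3 : ℕ → List ℕ
primeDivisors>3 n =
  filter (λ q → prime? q ×-dec (q ∣? n) ×-dec (3 ℕ.<? q)) (upTo (suc n))

weight : ℕ → ℚ
weight n =
  foldr _*_ 1ℚ
    (map (λ q → (1ℚ - fromℕ 3 * fromℕ q ⁻¹) ⁻¹) (primeDivisors>3 n))

CoprimeTo : ℤ → ℕ → Set
CoprimeTo Δ r = ℤ.gcd (+ r) Δ ≡ 1ℤ

SupportedOn : ℤ → ℕ → Set
SupportedOn Δ d = ∀ q → Prime q → q ℕ.∣ d → + q ℤ.∣ Δ

-- Quadruples (r₁ , r₂ , d₁ , d₂).
Index : Set
Index = ℕ × ℕ × ℕ × ℕ

Admissible : ℤ → Index → Set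
Admissible Δ (r₁ , r₂ , d₁ , d₂) =
  (1 ℕ.≤ r₁ × CoprimeTo Δ r₁) ×
  (1 ℕ.≤ r₂ × CoprimeTo Δ r₂) ×
  (1 ℕ.≤ d₁ × SupportedOn Δ d₁) ×
  (1 ℕ.≤ d₂ × SupportedOn Δ d₂)

term : Index → ℚ
term (r₁ , r₂ , d₁ , d₂) =
  weight (r₁ ℕ.* r₂) *
  fromℕ (ℕ.lcm (r₁ ℕ.^ 2 ℕ.* d₁) (r₂ ℕ.^ 2 ℕ.* d₂)) ⁻¹

{-# OPTIONS --safe #-}

-- Writing r₁ = ag, r₂ = bg, d₁ = ch, d₂ = dh with (a,b) = (c,d) = 1 gives
-- [r₁²d₁, r₂²d₂] ≥ (abg)²·cdh, because r₁r₂ is coprime to d₁d₂.  The weight is submultiplicative,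
-- so the series is dominated by the product of three copies of Σ weight(n)/n² and three copies of
-- Σ 1/d over numbers d whose prime factors are at most |Δ|.
-- The first converges since (q/(q-3))³ ≤ q² for q ≥ 5, hence weight(n)³ ≤ n²; the second is a
-- finite product of geometric series.  Constructively a bound on the partial sums gives no limit,
-- so each convergence is proved with an explicit Cauchy criterion.
module Submission where

open import Defs
open import Algebra.Core using (Op₂)
open import Algebra.Structures using (IsCommutativeMonoid)
open import Data.Integer.Base as ℤ using (ℤ; 0ℤ; 1ℤ; +[1+_]; +≤+; +<+)
open import Data.Integer.GCD as ℤ using ()
open import Data.Integer.Properties as ℤ using ()
open import Data.List.Base
  using (List; []; _∷_; _++_; map; foldr; filter; deduplicate; cartesianProduct; downFrom; upTo)
open import Data.List.Membership.DecPropositional as DecMembership using ()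
open import Data.List.Membership.Propositional using (_∈_; _∉_)
open import Data.List.Membership.Propositional.Properties
open import Data.List.Relation.Binary.Permutation.Propositional using (↭⇒↭ₛ)
open import Data.List.Relation.Binary.Permutation.Propositional.Properties using (map⁺; shift)
open import Data.List.Relation.Binary.Permutation.Setoid.Properties using (foldr-commMonoid)
open import Data.List.Relation.Binary.Subset.Propositional using (_⊆_)
open import Data.List.Relation.Unary.All as All using (All; []; _∷_)
open import Data.List.Relation.Unary.All.Properties as All using ()
open import Data.List.Relation.Unary.AllPairs using ([]; _∷_)
open import Data.List.Relation.Unary.Any using (here; there)
open import Data.List.Relation.Unary.Unique.DecPropositional.Properties as DecUnique using ()
open import Data.List.Relation.Unary.Unique.Propositional using (Unique)
open import Data.List.Relation.Unary.Unique.Propositional.Properties as Unique using (Unique[x∷xs]⇒x∉xs)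
open import Data.Nat.Base as ℕ using (ℕ; zero; suc; z≤n; s≤s)
open import Data.Nat.Coprimality using (Coprime; coprime-divisor)
open import Data.Nat.Divisibility as ℕ using (_∣_; _∣?_; divides)
open import Data.Nat.GCD as ℕ using ()
open import Data.Nat.Induction using (<-rec)
open import Data.Nat.LCM as ℕ using ()
open import Data.Nat.ListAction using (product)
open import Data.Nat.Primality
open import Data.Nat.Primality.Factorisation
open import Data.Nat.Properties as ℕ using ()
open import Data.List.Extrema ℕ.≤-totalOrder using (max; xs≤max)
open import Data.Nat.Solver as ℕ using ()
open import Data.Product.Base using (_×_; _,_; ∃-syntax; Σ-syntax; proj₁; proj₂; uncurry)
open import Data.Product.Properties using (≡-dec)
open import Data.Rational.Base
open import Data.Rational.Properties
open import Data.Rational.Solver using (module +-*-Solver)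
open import Data.Rational.Unnormalised.Base as ℚᵘ using (mkℚᵘ; *≡*; *≤*; *<*)
open import Data.Rational.Unnormalised.Properties as ℚᵘ using ()
open import Data.Sum.Base as Sum using (_⊎_; inj₁; inj₂)
open import Data.Unit.Base using (tt)
open import Function.Base using (_∘_)
open import Relation.Binary.Definitions using (DecidableEquality)
open import Relation.Binary.PropositionalEquality
open import Relation.Nullary using (Dec; yes; no; ¬_; ¬?; contradiction)
open import Relation.Nullary.Decidable using (_×-dec_; _→-dec_; map′)
open import Relation.Unary using (U; Decidable)

open FiniteSubset

-- Rational arithmetic

*-monoˡ-≤ : ∀ {r p q} → 0ℚ ≤ r → p ≤ q → r * p ≤ r * q
*-monoˡ-≤ {r} 0≤r = *-monoˡ-≤-nonNeg r {{nonNegative 0≤r}}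

*-monoʳ-≤ : ∀ {r p q} → 0ℚ ≤ r → p ≤ q → p * r ≤ q * r
*-monoʳ-≤ {r} 0≤r = *-monoʳ-≤-nonNeg r {{nonNegative 0≤r}}

*-mono-≤ : ∀ {p q r s} → 0ℚ ≤ q → 0ℚ ≤ r → p ≤ q → r ≤ s → p * r ≤ q * s
*-mono-≤ 0≤q 0≤r p≤q r≤s = ≤-trans (*-monoʳ-≤ 0≤r p≤q) (*-monoˡ-≤ 0≤q r≤s)

*-nonNeg : ∀ {p q} → 0ℚ ≤ p → 0ℚ ≤ q → 0ℚ ≤ p * q
*-nonNeg {p} 0≤p 0≤q = ≤-trans (≤-reflexive (sym (*-zeroʳ p))) (*-monoˡ-≤ 0≤p 0≤q)

*-pos : ∀ {p q} → 0ℚ < p → 0ℚ < q → 0ℚ < p * q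
*-pos {p} {q} 0<p 0<q =
  positive⁻¹ (p * q) {{pos*pos⇒pos p {{positive 0<p}} q {{positive 0<q}}}}

*-cancelʳ-≤ : ∀ {p q r} → 0ℚ < r → p * r ≤ q * r → p ≤ q
*-cancelʳ-≤ {r = r} 0<r = *-cancelʳ-≤-pos r {{positive 0<r}}

p≤p+q : ∀ {p q} → 0ℚ ≤ q → p ≤ p + q
p≤p+q {p} {q} 0≤q = ≤-trans (≤-reflexive (sym (+-identityʳ p))) (+-monoʳ-≤ p 0≤q)

q≤p+q : ∀ {p q} → 0ℚ ≤ p → q ≤ p + q
q≤p+q {p} {q} 0≤p = ≤-trans (≤-reflexive (sym (+-identityˡ q))) (+-monoˡ-≤ q 0≤p)

∣p-q∣≤r : ∀ p q r → p ≤ q + r → q ≤ p + r → ∣ p - q ∣ ≤ r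
∣p-q∣≤r p q r p≤q+r q≤p+r with ∣p∣≡p∨∣p∣≡-p (p - q)
... | inj₁ eq = begin
  ∣ p - q ∣      ≡⟨ eq ⟩
  p - q          ≤⟨ +-monoˡ-≤ (- q) p≤q+r ⟩
  q + r - q      ≡⟨ solve 2 (λ q r → q :+ r :- q := r) refl q r ⟩
  r              ∎
  where
  open ≤-Reasoning
  open +-*-Solver
... | inj₂ eq = begin
  ∣ p - q ∣      ≡⟨ eq ⟩
  - (p - q)      ≡⟨ solve 2 (λ p q → :- (p :- q) := q :- p) refl p q ⟩
  q - p          ≤⟨ +-monoˡ-≤ (- p) q≤p+r ⟩
  p + r - p      ≡⟨ solve 2 (λ q r → q :+ r :- q := r) refl p r ⟩
  r              ∎
  where
  open ≤-Reasoning
  open +-*-Solver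

*-⁻¹ : ∀ {p} → p ≢ 0ℚ → p * p ⁻¹ ≡ 1ℚ
*-⁻¹ {p} p≢0 with p ≟ 0ℚ
... | yes p≡0 = contradiction p≡0 p≢0
... | no  ≢0  = *-inverseʳ p {{≢-nonZero ≢0}}

pos⇒≢0 : ∀ {p} → 0ℚ < p → p ≢ 0ℚ
pos⇒≢0 0<p p≡0 = <⇒≢ 0<p (sym p≡0)

*-⁻¹-pos : ∀ {p} → 0ℚ < p → p * p ⁻¹ ≡ 1ℚ
*-⁻¹-pos 0<p = *-⁻¹ (pos⇒≢0 0<p)

⁻¹-pos : ∀ {p} → 0ℚ < p → 0ℚ < p ⁻¹
⁻¹-pos {p} 0<p with p ≟ 0ℚ
... | yes p≡0 = contradiction p≡0 (pos⇒≢0 0<p)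
... | no  ≢0  = positive⁻¹ _ {{1/pos⇒pos p {{positive 0<p}}}}

⁻¹-nonNeg : ∀ {p} → 0ℚ ≤ p → 0ℚ ≤ p ⁻¹
⁻¹-nonNeg {p} 0≤p with p ≟ 0ℚ
... | yes _ = ≤-refl
... | no ≢0 = <⇒≤ (positive⁻¹ _ {{1/pos⇒pos p {{nonNeg∧nonZero⇒pos p {{nonNegative 0≤p}} {{≢-nonZero ≢0}}}}}})

⁻¹-unique : ∀ p q → p * q ≡ 1ℚ → p ⁻¹ ≡ q
⁻¹-unique p q pq≡1 = begin
  p ⁻¹               ≡⟨ *-identityʳ (p ⁻¹) ⟨
  p ⁻¹ * 1ℚ          ≡⟨ cong (p ⁻¹ *_) pq≡1 ⟨
  p ⁻¹ * (p * q)     ≡⟨ solve 3 (λ a b c → a :* (b :* c) := (b :* a) :* c) refl (p ⁻¹) p q ⟩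
  p * p ⁻¹ * q       ≡⟨ cong (_* q) (*-⁻¹ p≢0) ⟩
  1ℚ * q             ≡⟨ *-identityˡ q ⟩
  q                  ∎
  where
  open ≡-Reasoning
  open +-*-Solver
  p≢0 : p ≢ 0ℚ
  p≢0 refl with () ← trans (sym pq≡1) (*-zeroˡ q)

⁻¹-* : ∀ {p q} → 0ℚ < p → 0ℚ < q → (p * q) ⁻¹ ≡ p ⁻¹ * q ⁻¹
⁻¹-* {p} {q} 0<p 0<q = ⁻¹-unique (p * q) (p ⁻¹ * q ⁻¹) (begin
  p * q * (p ⁻¹ * q ⁻¹)    ≡⟨ solve 4 (λ a b c d → a :* b :* (c :* d) := (a :* c) :* (b :* d)) refl p q (p ⁻¹) (q ⁻¹) ⟩
  p * p ⁻¹ * (q * q ⁻¹)    ≡⟨ cong₂ _*_ (*-⁻¹-pos 0<p) (*-⁻¹-pos 0<q) ⟩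
  1ℚ                       ∎)
  where
  open ≡-Reasoning
  open +-*-Solver

≤-*⁻¹ : ∀ {p q r} → 0ℚ < q → p * q ≤ r → p ≤ r * q ⁻¹
≤-*⁻¹ {p} {q} {r} 0<q pq≤r = begin
  p              ≡⟨ *-identityʳ p ⟨
  p * 1ℚ         ≡⟨ cong (p *_) (*-⁻¹-pos 0<q) ⟨
  p * (q * q ⁻¹) ≡⟨ *-assoc p q (q ⁻¹) ⟨
  p * q * q ⁻¹   ≤⟨ *-monoʳ-≤ (<⇒≤ (⁻¹-pos 0<q)) pq≤r ⟩
  r * q ⁻¹       ∎
  where open ≤-Reasoning

*⁻¹-≤ : ∀ {p q r} → 0ℚ < q → r ≤ p * q → r * q ⁻¹ ≤ p
*⁻¹-≤ {p} {q} {r} 0<q r≤pq = begin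
  r * q ⁻¹       ≤⟨ *-monoʳ-≤ (<⇒≤ (⁻¹-pos 0<q)) r≤pq ⟩
  p * q * q ⁻¹   ≡⟨ *-assoc p q (q ⁻¹) ⟩
  p * (q * q ⁻¹) ≡⟨ cong (p *_) (*-⁻¹-pos 0<q) ⟩
  p * 1ℚ         ≡⟨ *-identityʳ p ⟩
  p              ∎
  where open ≤-Reasoning

⁻¹-anti-≤ : ∀ {p q} → 0ℚ < p → p ≤ q → q ⁻¹ ≤ p ⁻¹
⁻¹-anti-≤ {p} {q} 0<p p≤q = begin
  q ⁻¹          ≡⟨ *-identityˡ (q ⁻¹) ⟨
  1ℚ * q ⁻¹     ≤⟨ *⁻¹-≤ (<-≤-trans 0<p p≤q) (begin
    1ℚ            ≡⟨ *-⁻¹-pos 0<p ⟨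
    p * p ⁻¹      ≤⟨ *-monoʳ-≤ (<⇒≤ (⁻¹-pos 0<p)) p≤q ⟩
    q * p ⁻¹      ≡⟨ *-comm q (p ⁻¹) ⟩
    p ⁻¹ * q      ∎) ⟩
  p ⁻¹          ∎
  where open ≤-Reasoning

toℚᵘ-fromℕ : ∀ n → toℚᵘ (fromℕ n) ℚᵘ.≃ mkℚᵘ (ℤ.+ n) 0
toℚᵘ-fromℕ n = toℚᵘ-fromℚᵘ (mkℚᵘ (ℤ.+ n) 0)

fromℕ-+ : ∀ m n → fromℕ (m ℕ.+ n) ≡ fromℕ m + fromℕ n
fromℕ-+ m n = toℚᵘ-injective (begin
  toℚᵘ (fromℕ (m ℕ.+ n))               ≈⟨ toℚᵘ-fromℕ (m ℕ.+ n) ⟩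
  mkℚᵘ (ℤ.+ (m ℕ.+ n)) 0
    ≈⟨ *≡* (cong (ℤ._* (ℤ.+ 1)) (sym (cong₂ ℤ._+_ (ℤ.*-identityʳ (ℤ.+ m)) (ℤ.*-identityʳ (ℤ.+ n))))) ⟩
  mkℚᵘ (ℤ.+ m) 0 ℚᵘ.+ mkℚᵘ (ℤ.+ n) 0       ≈⟨ ℚᵘ.+-cong (toℚᵘ-fromℕ m) (toℚᵘ-fromℕ n) ⟨
  toℚᵘ (fromℕ m) ℚᵘ.+ toℚᵘ (fromℕ n)   ≈⟨ toℚᵘ-homo-+ (fromℕ m) (fromℕ n) ⟨
  toℚᵘ (fromℕ m + fromℕ n)             ∎)
  where open ℚᵘ.≃-Reasoning

fromℕ-* : ∀ m n → fromℕ (m ℕ.* n) ≡ fromℕ m * fromℕ n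
fromℕ-* m n = toℚᵘ-injective (begin
  toℚᵘ (fromℕ (m ℕ.* n))               ≈⟨ toℚᵘ-fromℕ (m ℕ.* n) ⟩
  mkℚᵘ (ℤ.+ (m ℕ.* n)) 0                 ≈⟨ *≡* (cong (ℤ._* (ℤ.+ 1)) (ℤ.pos-* m n)) ⟩
  mkℚᵘ (ℤ.+ m) 0 ℚᵘ.* mkℚᵘ (ℤ.+ n) 0       ≈⟨ ℚᵘ.*-cong (toℚᵘ-fromℕ m) (toℚᵘ-fromℕ n) ⟨
  toℚᵘ (fromℕ m) ℚᵘ.* toℚᵘ (fromℕ n)   ≈⟨ toℚᵘ-homo-* (fromℕ m) (fromℕ n) ⟨
  toℚᵘ (fromℕ m * fromℕ n)             ∎)
  where open ℚᵘ.≃-Reasoning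

fromℕ-mono-≤ : ∀ {m n} → m ℕ.≤ n → fromℕ m ≤ fromℕ n
fromℕ-mono-≤ {m} {n} m≤n = toℚᵘ-cancel-≤ (begin
  toℚᵘ (fromℕ m)  ≃⟨ toℚᵘ-fromℕ m ⟩
  mkℚᵘ (ℤ.+ m) 0    ≤⟨ *≤* (ℤ.*-monoʳ-≤-nonNeg (ℤ.+ 1) (+≤+ m≤n)) ⟩
  mkℚᵘ (ℤ.+ n) 0    ≃⟨ toℚᵘ-fromℕ n ⟨
  toℚᵘ (fromℕ n)  ∎)
  where open ℚᵘ.≤-Reasoning

fromℕ-nonNeg : ∀ n → 0ℚ ≤ fromℕ n
fromℕ-nonNeg n = fromℕ-mono-≤ {0} {n} z≤n

fromℕ-pos : ∀ {n} → 1 ℕ.≤ n → 0ℚ < fromℕ n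
fromℕ-pos 1≤n = <-≤-trans (toℚᵘ-cancel-< (*<* (+<+ (s≤s z≤n)))) (fromℕ-mono-≤ 1≤n)

fromℕ⁻¹-nonNeg : ∀ n → 0ℚ ≤ fromℕ n ⁻¹
fromℕ⁻¹-nonNeg n = ⁻¹-nonNeg (fromℕ-nonNeg n)

fromℕ⁻¹-* : ∀ {m n} → 1 ℕ.≤ m → 1 ℕ.≤ n → fromℕ (m ℕ.* n) ⁻¹ ≡ fromℕ m ⁻¹ * fromℕ n ⁻¹
fromℕ⁻¹-* {m} {n} 1≤m 1≤n =
  trans (cong _⁻¹ (fromℕ-* m n)) (⁻¹-* (fromℕ-pos 1≤m) (fromℕ-pos 1≤n))

fromℕ⁻¹-anti-≤ : ∀ {m n} → 1 ℕ.≤ m → m ℕ.≤ n → fromℕ n ⁻¹ ≤ fromℕ m ⁻¹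
fromℕ⁻¹-anti-≤ 1≤m m≤n = ⁻¹-anti-≤ (fromℕ-pos 1≤m) (fromℕ-mono-≤ m≤n)

1/suc≡fromℕ⁻¹ : ∀ n → 1ℤ / suc n ≡ fromℕ (suc n) ⁻¹
1/suc≡fromℕ⁻¹ n = sym (⁻¹-unique (fromℕ (suc n)) (1ℤ / suc n) (toℚᵘ-injective (begin
  toℚᵘ (fromℕ (suc n) * (1ℤ / suc n))         ≈⟨ toℚᵘ-homo-* (fromℕ (suc n)) (1ℤ / suc n) ⟩
  toℚᵘ (fromℕ (suc n)) ℚᵘ.* toℚᵘ (1ℤ / suc n)
    ≈⟨ ℚᵘ.*-cong (toℚᵘ-fromℕ (suc n)) (toℚᵘ-fromℚᵘ (mkℚᵘ (ℤ.+ 1) n)) ⟩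
  mkℚᵘ (ℤ.+ suc n) 0 ℚᵘ.* mkℚᵘ (ℤ.+ 1) n
    ≈⟨ *≡* (cong ℤ.+_ (trans (ℕ.*-identityʳ _) (trans (ℕ.*-identityʳ (suc n))
         (sym (trans (ℕ.*-identityˡ _) (ℕ.*-identityˡ (suc n))))))) ⟩
  toℚᵘ 1ℚ                                      ∎)))
  where open ℚᵘ.≃-Reasoning

0<1/suc : ∀ n → 0ℚ < 1ℤ / suc n
0<1/suc n = subst (0ℚ <_) (sym (1/suc≡fromℕ⁻¹ n)) (⁻¹-pos (fromℕ-pos {suc n} (s≤s z≤n)))

archimedean : ∀ {ε} → 0ℚ < ε → ∃[ n ] 1ℤ / suc n ≤ ε
archimedean {mkℚ +[1+ p ] d c} _ = d , toℚᵘ-cancel-≤ (begin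
  toℚᵘ (1ℤ / suc d)  ≃⟨ toℚᵘ-fromℚᵘ (mkℚᵘ (ℤ.+ 1) d) ⟩
  mkℚᵘ (ℤ.+ 1) d        ≤⟨ *≤* (ℤ.*-monoʳ-≤-nonNeg (ℤ.+ suc d) {ℤ.+ 1} {+[1+ p ]} (+≤+ (s≤s z≤n))) ⟩
  mkℚᵘ +[1+ p ] d     ∎)
  where open ℚᵘ.≤-Reasoning
archimedean {mkℚ (ℤ.+ 0) d c} (*<* (+<+ ()))
archimedean {mkℚ (ℤ.-[1+_] p) d c} (*<* ())

shrink : ∀ {ε b} → 0ℚ < ε → 0ℚ < b → ∃[ δ ] 0ℚ < δ × δ * b ≡ ε
shrink {ε} {b} 0<ε 0<b = ε * b ⁻¹ , *-pos 0<ε (⁻¹-pos 0<b) , (begin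
  ε * b ⁻¹ * b     ≡⟨ solve 3 (λ a b c → a :* c :* b := a :* (b :* c)) refl ε b (b ⁻¹) ⟩
  ε * (b * b ⁻¹)   ≡⟨ cong (ε *_) (*-⁻¹-pos 0<b) ⟩
  ε * 1ℚ           ≡⟨ *-identityʳ ε ⟩
  ε                ∎)
  where
  open ≡-Reasoning
  open +-*-Solver

-- Finite and unordered sums

module _ {_∙_ : Op₂ ℚ} {ε} (isCM : IsCommutativeMonoid _≡_ _∙_ ε)
         {I : Set} {a : I → ℚ} {Good : I → Set}
         (ε≤ : ∀ {is} → All Good is → ε ≤ foldr _∙_ ε (map a is))
         (mono : ∀ {i p q} → Good i → p ≤ q → a i ∙ p ≤ a i ∙ q)
         where

  foldr-mono-⊆ : ∀ {is js} → Unique is → is ⊆ js → All Good js →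
                 foldr _∙_ ε (map a is) ≤ foldr _∙_ ε (map a js)
  foldr-mono-⊆ {[]} _ _ good = ε≤ good
  foldr-mono-⊆ {i ∷ is} {js} !is@(_ ∷ !is′) is⊆js good
    with ks , ls , refl ← ∈-∃++ (is⊆js (here refl)) = begin
    a i ∙ foldr _∙_ ε (map a is)
      ≤⟨ mono (All.lookup good (is⊆js (here refl))) (foldr-mono-⊆ !is′ is⊆ good′) ⟩
    a i ∙ foldr _∙_ ε (map a (ks ++ ls))
      ≡⟨ foldr-commMonoid (setoid ℚ) isCM (↭⇒↭ₛ (map⁺ a (shift i ks ls))) ⟨
    foldr _∙_ ε (map a (ks ++ i ∷ ls)) ∎
    where
    open ≤-Reasoning
    good′ : All Good (ks ++ ls)
    good′ = All.++⁺ (All.++⁻ˡ ks good) (All.tail (All.++⁻ʳ ks good))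
    is⊆ : is ⊆ ks ++ ls
    is⊆ j∈is with ∈-++⁻ ks (is⊆js (there j∈is))
    ... | inj₁ j∈ks = ∈-++⁺ˡ j∈ks
    ... | inj₂ (here refl) = contradiction j∈is (Unique[x∷xs]⇒x∉xs !is)
    ... | inj₂ (there j∈ls) = ∈-++⁺ʳ ks j∈ls

NonNeg : {I : Set} → (I → ℚ) → Set
NonNeg a = ∀ i → 0ℚ ≤ a i

module _ {I : Set} where

  sum-++ : ∀ (a : I → ℚ) is js → sum a (is ++ js) ≡ sum a is + sum a js
  sum-++ a []       js = sym (+-identityˡ (sum a js))
  sum-++ a (i ∷ is) js = trans (cong (a i +_) (sum-++ a is js)) (sym (+-assoc (a i) (sum a is) (sum a js)))

  sum-nonNeg : ∀ {a : I → ℚ} → NonNeg a → ∀ is → 0ℚ ≤ sum a is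
  sum-nonNeg 0≤a []       = ≤-refl
  sum-nonNeg 0≤a (i ∷ is) = ≤-trans (sum-nonNeg 0≤a is) (q≤p+q (0≤a i))

  sum-mono-⊆ : ∀ {a : I → ℚ} → NonNeg a → ∀ {is js} → Unique is → is ⊆ js → sum a is ≤ sum a js
  sum-mono-⊆ {a} 0≤a {js = js} !is is⊆js =
    foldr-mono-⊆ +-0-isCommutativeMonoid {Good = λ _ → 0ℚ ≤ 0ℚ} (λ {ks} _ → sum-nonNeg 0≤a ks)
      (λ {i} _ → +-monoʳ-≤ (a i)) !is is⊆js (All.universal (λ _ → ≤-refl) js)

  sum-filter : ∀ (a : I → ℚ) {P : I → Set} (P? : Decidable P) is →
               sum a is ≡ sum a (filter P? is) + sum a (filter (¬? ∘ P?) is)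
  sum-filter a P? [] = sym (+-identityˡ 0ℚ)
  sum-filter a P? (i ∷ is) with P? i
  ... | yes _ = trans (cong (a i +_) (sum-filter a P? is)) (sym (+-assoc (a i) _ _))
  ... | no  _ = trans (cong (a i +_) (sum-filter a P? is))
                      (solve 3 (λ x y z → x :+ (y :+ z) := y :+ (x :+ z)) refl
                        (a i) (sum a (filter P? is)) (sum a (filter (¬? ∘ P?) is)))
    where open +-*-Solver

  filter-FiniteSubset : ∀ {P Q : I → Set} (Q? : Decidable Q) {is} →
                        FiniteSubset P is → FiniteSubset P (filter Q? is)
  filter-FiniteSubset Q? fin = record
    { members  = All.filter⁺ Q? (members fin)
    ; distinct = Unique.filter⁺ Q? (distinct fin)
    }

-- The Cauchy criterion for unordered sums of nonnegative terms.
Summable : {I : Set} → (I → Set) → (I → ℚ) → Set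
Summable P a = ∀ ε → 0ℚ < ε →
  ∃[ is₀ ] (∀ {is} → FiniteSubset P is → (∀ {i} → i ∈ is → i ∉ is₀) → sum a is ≤ ε)

module _ {I : Set} (_≟ᴵ_ : DecidableEquality I) {P : I → Set} {a : I → ℚ} (0≤a : NonNeg a) where

  open DecMembership _≟ᴵ_ using (_∈?_)

  sum≤sum+tail : ∀ {is₀ ε} →
    (∀ {is} → FiniteSubset P is → (∀ {i} → i ∈ is → i ∉ is₀) → sum a is ≤ ε) →
    ∀ {is} → FiniteSubset P is → sum a is ≤ sum a is₀ + ε
  sum≤sum+tail {is₀} {ε} tail {is} fin = begin
    sum a is                                        ≡⟨ sum-filter a ∈₀? is ⟩
    sum a (filter ∈₀? is) + sum a (filter ∉₀? is)   ≤⟨ +-mono-≤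
      (sum-mono-⊆ 0≤a (Unique.filter⁺ ∈₀? (distinct fin)) (proj₂ ∘ ∈-filter⁻ ∈₀? {xs = is}))
      (tail (filter-FiniteSubset ∉₀? fin) (proj₂ ∘ ∈-filter⁻ ∉₀? {xs = is})) ⟩
    sum a is₀ + ε                                   ∎
    where
    open ≤-Reasoning
    ∈₀? = _∈? is₀
    ∉₀? = ¬? ∘ ∈₀?

  summable⇒bounded : Summable P a →
    ∃[ b ] 0ℚ < b × (∀ {is} → FiniteSubset P is → sum a is ≤ b)
  summable⇒bounded summable with is₀ , tail ← summable 1ℚ (positive⁻¹ 1ℚ) =
    sum a is₀ + 1ℚ , <-≤-trans (positive⁻¹ 1ℚ) (q≤p+q (sum-nonNeg 0≤a is₀)) , sum≤sum+tail tail

  summable⇒hasSum : Decidable P → Summable P a →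
    Σ[ c ∈ ℚ ] Σ[ s ∈ ℝ ] (HasSum P a s × s ≤ᴿ c)
  summable⇒hasSum P? summable = approx₀ 0 + (1ℤ / 1) , s , hasSum , bound
    where
    open +-*-Solver
    ε : ℕ → ℚ
    ε n = 1ℤ / suc n

    is₀ : ℕ → List I
    is₀ n = deduplicate _≟ᴵ_ (filter P? (proj₁ (summable (ε n) (0<1/suc n))))

    is₀-fin : ∀ n → FiniteSubset P (is₀ n)
    is₀-fin n = record
      { members  = All.deduplicate⁺ _≟ᴵ_ (All.all-filter P? (proj₁ (summable (ε n) (0<1/suc n))))
      ; distinct = DecUnique.deduplicate-! _≟ᴵ_ _
      }

    approx₀ : ℕ → ℚ
    approx₀ n = sum a (is₀ n)

    sum≤approx : ∀ n {is} → FiniteSubset P is → sum a is ≤ approx₀ n + ε n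
    sum≤approx n = sum≤sum+tail λ {is} fin avoids →
      proj₂ (summable (ε n) (0<1/suc n)) fin λ i∈is i∈is₀ → avoids i∈is
        (∈-deduplicate⁺ _≟ᴵ_ (∈-filter⁺ P? i∈is₀ (All.lookup (members fin) i∈is)))

    approx≤ : ∀ m n → approx₀ m ≤ approx₀ n + (ε m + ε n)
    approx≤ m n = ≤-trans (sum≤approx n (is₀-fin m))
      (+-monoʳ-≤ (approx₀ n) (q≤p+q (<⇒≤ (0<1/suc m))))

    s : ℝ
    s = record
      { approx  = approx₀
      ; regular = λ m n → ∣p-q∣≤r (approx₀ m) (approx₀ n) (ε m + ε n) (approx≤ m n)
          (≤-trans (approx≤ n m) (≤-reflexive (cong (approx₀ m +_) (+-comm (ε n) (ε m)))))
      }

    within : ∀ k {δ} → 0ℚ < δ → ε k ≤ δ →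
             ∀ is → FiniteSubset P is → is₀ k ⊆ is → Within δ (sum a is) s
    within k {δ} 0<δ ε≤δ is fin is₀⊆is n = ∣p-q∣≤r (sum a is) (approx₀ n) (δ + ε n)
      (≤-trans (sum≤approx n fin) (+-monoʳ-≤ (approx₀ n) (q≤p+q (<⇒≤ 0<δ))))
      (begin
        approx₀ n                ≤⟨ sum≤approx k (is₀-fin n) ⟩
        approx₀ k + ε k          ≤⟨ +-mono-≤ (sum-mono-⊆ 0≤a (distinct (is₀-fin k)) is₀⊆is) ε≤δ ⟩
        sum a is + δ             ≤⟨ +-monoʳ-≤ (sum a is) (p≤p+q (<⇒≤ (0<1/suc n))) ⟩
        sum a is + (δ + ε n)     ∎)
      where open ≤-Reasoning

    hasSum : HasSum P a s
    hasSum δ 0<δ = is₀ k , is₀-fin k , within k 0<δ (proj₂ (archimedean 0<δ))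
      where k = proj₁ (archimedean 0<δ)

    bound : s ≤ᴿ (approx₀ 0 + (1ℤ / 1))
    bound n = ≤-trans (approx≤ n 0) (≤-reflexive
      (solve 3 (λ x y z → x :+ (y :+ z) := x :+ z :+ y) refl (approx₀ 0) (ε n) (ε 0)))

lift-along : ∀ {I J : Set} (ψ : J → I) {P : I → Set} {Q : J → Set} {a : I → ℚ} {b : J → ℚ} →
  (∀ i → P i → ∃[ j ] Q j × ψ j ≡ i × a i ≤ b j) →
  ∀ {is} → All P is → ∃[ js ] All Q js × map ψ js ≡ is × sum a is ≤ sum b js
lift-along ψ lift [] = [] , [] , refl , ≤-refl
lift-along ψ lift {i ∷ is} (p ∷ ps)
  with j , q , refl , ai≤bj ← lift i p | js , qs , refl , ≤js ← lift-along ψ lift ps =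
  j ∷ js , q ∷ qs , refl , +-mono-≤ ai≤bj ≤js

summable-along : ∀ {I J : Set} (ψ : J → I) {P : I → Set} {Q : J → Set} {a : I → ℚ} {b : J → ℚ} →
  (∀ i → P i → ∃[ j ] Q j × ψ j ≡ i × a i ≤ b j) →
  Summable Q b → Summable P a
summable-along ψ {P} {a = a} lift summable ε 0<ε with js₀ , tail ← summable ε 0<ε =
  map ψ js₀ , bound
  where
  bound : ∀ {is} → FiniteSubset P is → (∀ {i} → i ∈ is → i ∉ map ψ js₀) → sum a is ≤ ε
  bound fin avoids with js , qs , refl , ≤js ← lift-along ψ lift (members fin) =
    ≤-trans ≤js (tail (record { members = qs ; distinct = Unique.map⁻ (distinct fin) })
      (λ j∈js j∈js₀ → avoids (∈-map⁺ ψ j∈js) (∈-map⁺ ψ j∈js₀)))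

infixr 7 _⊗_

_⊗_ : {I J : Set} → (I → ℚ) → (J → ℚ) → I × J → ℚ
(a ⊗ b) (i , j) = a i * b j

infixr 2 _⟨×⟩_

_⟨×⟩_ : {I J : Set} → (I → Set) → (J → Set) → I × J → Set
(P ⟨×⟩ Q) (i , j) = P i × Q j

⊗-nonNeg : ∀ {I J : Set} {a : I → ℚ} {b : J → ℚ} → NonNeg a → NonNeg b → NonNeg (a ⊗ b)
⊗-nonNeg 0≤a 0≤b (i , j) = *-nonNeg (0≤a i) (0≤b j)

sum-cartesianProduct : ∀ {I J : Set} (a : I → ℚ) (b : J → ℚ) is js →
  sum (a ⊗ b) (cartesianProduct is js) ≡ sum a is * sum b js
sum-cartesianProduct a b []       js = sym (*-zeroˡ (sum b js))
sum-cartesianProduct a b (i ∷ is) js = begin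
  sum (a ⊗ b) (map (i ,_) js ++ cartesianProduct is js)
    ≡⟨ sum-++ (a ⊗ b) (map (i ,_) js) _ ⟩
  sum (a ⊗ b) (map (i ,_) js) + sum (a ⊗ b) (cartesianProduct is js)
    ≡⟨ cong₂ _+_ (row js) (sum-cartesianProduct a b is js) ⟩
  a i * sum b js + sum a is * sum b js
    ≡⟨ *-distribʳ-+ (sum b js) (a i) (sum a is) ⟨
  (a i + sum a is) * sum b js ∎
  where
  open ≡-Reasoning
  row : ∀ ks → sum (a ⊗ b) (map (i ,_) ks) ≡ a i * sum b ks
  row []       = sym (*-zeroʳ (a i))
  row (k ∷ ks) = trans (cong (a i * b k +_) (row ks)) (sym (*-distribˡ-+ (a i) (b k) (sum b ks)))

module _ {I J : Set} (_≟ᴵ_ : DecidableEquality I) (_≟ᴶ_ : DecidableEquality J)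
         {P : I → Set} {Q : J → Set} {a : I → ℚ} {b : J → ℚ}
         (0≤a : NonNeg a) (0≤b : NonNeg b) where

  open DecMembership _≟ᴵ_ using (_∈?_)

  private
    firsts : List (I × J) → List I
    firsts = deduplicate _≟ᴵ_ ∘ map proj₁

    seconds : List (I × J) → List J
    seconds = deduplicate _≟ᴶ_ ∘ map proj₂

    firsts-FiniteSubset : ∀ {ijs} → FiniteSubset (P ⟨×⟩ Q) ijs → FiniteSubset P (firsts ijs)
    firsts-FiniteSubset fin = record
      { members  = All.deduplicate⁺ _≟ᴵ_ (All.map⁺ (All.map proj₁ (members fin)))
      ; distinct = DecUnique.deduplicate-! _≟ᴵ_ _
      }

    seconds-FiniteSubset : ∀ {ijs} → FiniteSubset (P ⟨×⟩ Q) ijs → FiniteSubset Q (seconds ijs)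
    seconds-FiniteSubset fin = record
      { members  = All.deduplicate⁺ _≟ᴶ_ (All.map⁺ (All.map proj₂ (members fin)))
      ; distinct = DecUnique.deduplicate-! _≟ᴶ_ _
      }

    sum≤firsts*seconds : ∀ {ijs} → Unique ijs →
      sum (a ⊗ b) ijs ≤ sum a (firsts ijs) * sum b (seconds ijs)
    sum≤firsts*seconds {ijs} !ijs = ≤-trans
      (sum-mono-⊆ (⊗-nonNeg 0≤a 0≤b) !ijs λ ij∈ → ∈-cartesianProduct⁺
        (∈-deduplicate⁺ _≟ᴵ_ (∈-map⁺ proj₁ ij∈)) (∈-deduplicate⁺ _≟ᴶ_ (∈-map⁺ proj₂ ij∈)))
      (≤-reflexive (sum-cartesianProduct a b (firsts ijs) (seconds ijs)))

    ⊗-tail : ∀ {is₀ js₀ δᵃ δᵇ boundᵃ boundᵇ ε} →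
      0ℚ ≤ boundᵃ → 0ℚ ≤ δᵃ →
      (∀ {is} → FiniteSubset P is → sum a is ≤ boundᵃ) →
      (∀ {js} → FiniteSubset Q js → sum b js ≤ boundᵇ) →
      (∀ {is} → FiniteSubset P is → (∀ {i} → i ∈ is → i ∉ is₀) → sum a is ≤ δᵃ) →
      (∀ {js} → FiniteSubset Q js → (∀ {j} → j ∈ js → j ∉ js₀) → sum b js ≤ δᵇ) →
      boundᵃ * δᵇ + δᵃ * boundᵇ ≤ ε →
      ∀ {ijs} → FiniteSubset (P ⟨×⟩ Q) ijs →
      (∀ {ij} → ij ∈ ijs → ij ∉ cartesianProduct is₀ js₀) → sum (a ⊗ b) ijs ≤ ε
    ⊗-tail {is₀} {js₀} {δᵃ} {δᵇ} {boundᵃ} {boundᵇ} {ε}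
           0≤boundᵃ 0≤δᵃ ≤boundᵃ ≤boundᵇ tailᵃ tailᵇ ≤ε {ijs} fin avoids = begin
      sum (a ⊗ b) ijs
        ≡⟨ sum-filter (a ⊗ b) ∈₀? ijs ⟩
      sum (a ⊗ b) inside + sum (a ⊗ b) outside
        ≤⟨ +-mono-≤ (sum≤firsts*seconds (distinct inside-fin)) (sum≤firsts*seconds (distinct outside-fin)) ⟩
      sum a (firsts inside) * sum b (seconds inside) + sum a (firsts outside) * sum b (seconds outside)
        ≤⟨ +-mono-≤
             (*-mono-≤ 0≤boundᵃ (sum-nonNeg 0≤b (seconds inside))
               (≤boundᵃ (firsts-FiniteSubset inside-fin)) (tailᵇ (seconds-FiniteSubset inside-fin) seconds∉))
             (*-mono-≤ 0≤δᵃ (sum-nonNeg 0≤b (seconds outside))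
               (tailᵃ (firsts-FiniteSubset outside-fin) firsts∉) (≤boundᵇ (seconds-FiniteSubset outside-fin))) ⟩
      boundᵃ * δᵇ + δᵃ * boundᵇ
        ≤⟨ ≤ε ⟩
      ε ∎
      where
      open ≤-Reasoning
      ∈₀? : Decidable (λ (ij : I × J) → proj₁ ij ∈ is₀)
      ∈₀? ij = proj₁ ij ∈? is₀
      ∉₀? = ¬? ∘ ∈₀?
      inside = filter ∈₀? ijs
      outside = filter ∉₀? ijs
      inside-fin = filter-FiniteSubset ∈₀? fin
      outside-fin = filter-FiniteSubset ∉₀? fin

      firsts∉ : ∀ {i} → i ∈ firsts outside → i ∉ is₀
      firsts∉ i∈ with ij , ij∈ , refl ← ∈-map⁻ proj₁ (∈-deduplicate⁻ _≟ᴵ_ _ i∈) =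
        proj₂ (∈-filter⁻ ∉₀? {xs = ijs} ij∈)

      seconds∉ : ∀ {j} → j ∈ seconds inside → j ∉ js₀
      seconds∉ j∈ j∈js₀ with ij , ij∈ , refl ← ∈-map⁻ proj₂ (∈-deduplicate⁻ _≟ᴶ_ _ j∈) =
        let ij∈ijs , i∈is₀ = ∈-filter⁻ ∈₀? {xs = ijs} ij∈ in
        avoids ij∈ijs (∈-cartesianProduct⁺ i∈is₀ j∈js₀)

  summable-⊗ : Summable P a → Summable Q b → Summable (P ⟨×⟩ Q) (a ⊗ b)
  summable-⊗ summableᵃ summableᵇ ε 0<ε =
    let boundᵃ , 0<boundᵃ , ≤boundᵃ = summable⇒bounded _≟ᴵ_ 0≤a summableᵃ
        boundᵇ , 0<boundᵇ , ≤boundᵇ = summable⇒bounded _≟ᴶ_ 0≤b summableᵇ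
        0<ε/2 = *-pos (positive⁻¹ ½) 0<ε
        δᵃ , 0<δᵃ , δᵃ-eq = shrink 0<ε/2 0<boundᵇ
        δᵇ , 0<δᵇ , δᵇ-eq = shrink 0<ε/2 0<boundᵃ
        is₀ , tailᵃ = summableᵃ δᵃ 0<δᵃ
        js₀ , tailᵇ = summableᵇ δᵇ 0<δᵇ
    in cartesianProduct is₀ js₀ ,
       ⊗-tail (<⇒≤ 0<boundᵃ) (<⇒≤ 0<δᵃ) ≤boundᵃ ≤boundᵇ tailᵃ tailᵇ
         (≤-reflexive (trans (cong₂ _+_ (trans (*-comm boundᵃ δᵇ) δᵇ-eq) δᵃ-eq) (half+half ε)))
    where
    half+half : ∀ p → ½ * p + ½ * p ≡ p
    half+half p = trans (sym (*-distribʳ-+ p ½ ½)) (*-identityˡ p)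

-- Partial sums are controlled at the checkpoints t k, where u k bounds the rest of the series.
summable-ℕ : ∀ {a : ℕ → ℚ} {P : ℕ → Set} (t : ℕ → ℕ) (u : ℕ → ℚ) → NonNeg a → NonNeg u →
  (∀ k → k ℕ.≤ t k) →
  (∀ k → sum a (downFrom (t (suc k))) + u (suc k) ≤ sum a (downFrom (t k)) + u k) →
  (∀ ε → 0ℚ < ε → ∃[ k ] u k ≤ ε) →
  Summable P a
summable-ℕ {a} {P} t u 0≤a 0≤u k≤t step u→0 ε 0<ε with k , u≤ε ← u→0 ε 0<ε =
  downFrom (t k) , bound
  where
  open ≤-Reasoning
  open +-*-Solver
  steps : ∀ m → sum a (downFrom (t (m ℕ.+ k))) + u (m ℕ.+ k) ≤ sum a (downFrom (t k)) + u k
  steps zero    = ≤-refl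
  steps (suc m) = ≤-trans (step (m ℕ.+ k)) (steps m)

  bound : ∀ {ns} → FiniteSubset P ns → (∀ {n} → n ∈ ns → n ∉ downFrom (t k)) → sum a ns ≤ ε
  bound {ns} fin avoids = begin
    sum a ns                                     ≡⟨ solve 2 (λ x y → x := x :+ y :- y) refl (sum a ns) s ⟩
    sum a ns + s - s                             ≡⟨ cong (_- s) (sum-++ a ns (downFrom (t k))) ⟨
    sum a (ns ++ downFrom (t k)) - s
      ≤⟨ +-monoˡ-≤ (- s) (sum-mono-⊆ 0≤a
           (Unique.++⁺ (distinct fin) (Unique.downFrom⁺ (t k)) (uncurry avoids)) covered) ⟩
    sum a (downFrom (t m)) - s
      ≤⟨ +-monoˡ-≤ (- s) (≤-trans (p≤p+q {sum a (downFrom (t m))} (0≤u m)) (steps l)) ⟩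
    s + u k - s                                  ≡⟨ solve 2 (λ x y → x :+ y :- x := y) refl s (u k) ⟩
    u k                                          ≤⟨ u≤ε ⟩
    ε                                            ∎
    where
    s = sum a (downFrom (t k))
    l = suc (max 0 ns) ℕ.+ t k
    m = l ℕ.+ k
    l≤t : l ℕ.≤ t m
    l≤t = ℕ.≤-trans (ℕ.m≤m+n l k) (k≤t m)
    covered : ns ++ downFrom (t k) ⊆ downFrom (t m)
    covered n∈ with ∈-++⁻ ns n∈
    ... | inj₁ n∈ns = ∈-downFrom⁺ (ℕ.≤-trans (s≤s (All.lookup (xs≤max 0 ns) n∈ns))
                        (ℕ.≤-trans (ℕ.m≤m+n (suc (max 0 ns)) (t k)) l≤t))
    ... | inj₂ n∈t  = ∈-downFrom⁺ (ℕ.<-≤-trans (∈-downFrom⁻ n∈t) (ℕ.≤-trans (ℕ.m≤n+m (t k) (suc (max 0 ns))) l≤t))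

sum-downFrom-+-≤ : ∀ {a : ℕ → ℚ} {c} m l → (∀ n → m ℕ.≤ n → n ℕ.< m ℕ.+ l → a n ≤ c) →
  sum a (downFrom (m ℕ.+ l)) ≤ sum a (downFrom m) + fromℕ l * c
sum-downFrom-+-≤ {a} {c} m zero a≤c = ≤-reflexive (begin
  sum a (downFrom (m ℕ.+ 0))     ≡⟨ cong (sum a ∘ downFrom) (ℕ.+-identityʳ m) ⟩
  sum a (downFrom m)             ≡⟨ +-identityʳ _ ⟨
  sum a (downFrom m) + 0ℚ        ≡⟨ cong (sum a (downFrom m) +_) (*-zeroˡ c) ⟨
  sum a (downFrom m) + 0ℚ * c    ∎)
  where open ≡-Reasoning
sum-downFrom-+-≤ {a} {c} m (suc l) a≤c rewrite ℕ.+-suc m l = begin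
  a (m ℕ.+ l) + sum a (downFrom (m ℕ.+ l))
    ≤⟨ +-mono-≤ (a≤c (m ℕ.+ l) (ℕ.m≤m+n m l) ℕ.≤-refl)
         (sum-downFrom-+-≤ m l λ n m≤n n<m+l → a≤c n m≤n (ℕ.m≤n⇒m≤1+n n<m+l)) ⟩
  c + (sum a (downFrom m) + fromℕ l * c)
    ≡⟨ solve 3 (λ c s l → c :+ (s :+ l :* c) := s :+ (con 1ℚ :+ l) :* c) refl c (sum a (downFrom m)) (fromℕ l) ⟩
  sum a (downFrom m) + (1ℚ + fromℕ l) * c
    ≡⟨ cong (λ x → sum a (downFrom m) + x * c) (fromℕ-+ 1 l) ⟨
  sum a (downFrom m) + fromℕ (suc l) * c ∎
  where
  open ≤-Reasoning
  open +-*-Solver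

-- Primes and divisibility

no-prime-divisor⇒≡1 : ∀ {n} → 1 ℕ.≤ n → (∀ p → Prime p → ¬ p ∣ n) → n ≡ 1
no-prime-divisor⇒≡1 {n} 1≤n ∤n with factorise n {{ℕ.>-nonZero 1≤n}}
... | record { factors = []     ; isFactorisation = eq }                     = eq
... | record { factors = p ∷ ps ; isFactorisation = eq ; factorsPrime = prime-p ∷ _ } =
  contradiction (divides (product ps) (trans eq (ℕ.*-comm p (product ps)))) (∤n p prime-p)

prime∣prime⇒≡ : ∀ {p q} → Prime p → Prime q → p ∣ q → p ≡ q
prime∣prime⇒≡ prime-p prime-q p∣q with prime⇒irreducible prime-q p∣q
... | inj₁ refl = contradiction prime-p ¬prime[1]
... | inj₂ p≡q  = p≡q

∣-pos : ∀ {d n} → 1 ℕ.≤ n → d ∣ n → 1 ℕ.≤ d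
∣-pos {zero}  1≤n 0∣n = contradiction (ℕ.0∣⇒≡0 0∣n) (ℕ.>⇒≢ 1≤n)
∣-pos {suc d} _   _   = s≤s z≤n

no-common-prime⇒coprime : ∀ {m n} → 1 ℕ.≤ m → (∀ p → Prime p → p ∣ m → ¬ p ∣ n) → Coprime m n
no-common-prime⇒coprime 1≤m no-common (d∣m , d∣n) = no-prime-divisor⇒≡1 (∣-pos 1≤m d∣m)
  λ p prime-p p∣d → no-common p prime-p (ℕ.∣-trans p∣d d∣m) (ℕ.∣-trans p∣d d∣n)

coprime⇒*-∣ : ∀ {m n k} → Coprime m n → m ∣ k → n ∣ k → m ℕ.* n ∣ k
coprime⇒*-∣ {m} {n} coprime m∣k (divides c refl) =
  ℕ.*-monoˡ-∣ n (coprime-divisor coprime (subst (m ∣_) (ℕ.*-comm c n) m∣k))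

product-∣ : ∀ {n ps} → Unique ps → All Prime ps → All (_∣ n) ps → product ps ∣ n
product-∣ {n} [] [] [] = ℕ.1∣ n
product-∣ {n} {q ∷ ps} !ps@(_ ∷ !ps′) (prime-q ∷ primes) (q∣n ∷ ps∣n) =
  coprime⇒*-∣ (no-common-prime⇒coprime (ℕ.>-nonZero⁻¹ q {{prime⇒nonZero prime-q}}) no-common)
    q∣n (product-∣ !ps′ primes ps∣n)
  where
  no-common : ∀ p → Prime p → p ∣ q → ¬ p ∣ product ps
  no-common p prime-p p∣q p∣product with refl ← prime∣prime⇒≡ prime-p prime-q p∣q =
    Unique[x∷xs]⇒x∉xs !ps (factorisationHasAllPrimeFactors prime-p p∣product primes)

extract-power : ∀ q → 2 ℕ.≤ q → ∀ n → 1 ℕ.≤ n → ∃[ e ] ∃[ m ] q ℕ.^ e ℕ.* m ≡ n × ¬ q ∣ m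
extract-power q 2≤q = <-rec _ go
  where
  go : ∀ n → (∀ {m} → m ℕ.< n → 1 ℕ.≤ m → ∃[ e ] ∃[ m′ ] q ℕ.^ e ℕ.* m′ ≡ m × ¬ q ∣ m′) →
       1 ℕ.≤ n → ∃[ e ] ∃[ m ] q ℕ.^ e ℕ.* m ≡ n × ¬ q ∣ m
  go n rec 1≤n with q ∣? n
  ... | no  q∤n = 0 , n , ℕ.*-identityˡ n , q∤n
  ... | yes (divides c refl) =
    let 1≤c = ∣-pos 1≤n (ℕ.m∣m*n q)
        e , m , eq , q∤m = rec (ℕ.m<m*n c q {{ℕ.>-nonZero 1≤c}} 2≤q) 1≤c
    in suc e , m , trans (ℕ.*-assoc q (q ℕ.^ e) m) (trans (cong (q ℕ.*_) eq) (ℕ.*-comm q c)) , q∤m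

1≤2^ : ∀ n → 1 ℕ.≤ 2 ℕ.^ n
1≤2^ n = ℕ.m^n>0 2 n

n<2^n : ∀ n → n ℕ.< 2 ℕ.^ n
n<2^n zero    = s≤s z≤n
n<2^n (suc n) = begin
  suc (suc n)                ≤⟨ s≤s (n<2^n n) ⟩
  1 ℕ.+ 2 ℕ.^ n              ≤⟨ ℕ.+-monoˡ-≤ (2 ℕ.^ n) (1≤2^ n) ⟩
  2 ℕ.^ n ℕ.+ 2 ℕ.^ n        ≡⟨ cong (2 ℕ.^ n ℕ.+_) (ℕ.+-identityʳ (2 ℕ.^ n)) ⟨
  2 ℕ.^ suc n                ∎
  where open ℕ.≤-Reasoning

2⁻^ : ℕ → ℚ
2⁻^ n = fromℕ (2 ℕ.^ n) ⁻¹

2⁻^-nonNeg : NonNeg 2⁻^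
2⁻^-nonNeg n = fromℕ⁻¹-nonNeg (2 ℕ.^ n)

2*2⁻^suc : ∀ n → fromℕ 2 * 2⁻^ (suc n) ≡ 2⁻^ n
2*2⁻^suc n = begin
  fromℕ 2 * 2⁻^ (suc n)            ≡⟨ cong (fromℕ 2 *_) (fromℕ⁻¹-* {2} {2 ℕ.^ n} (s≤s z≤n) (1≤2^ n)) ⟩
  fromℕ 2 * (fromℕ 2 ⁻¹ * 2⁻^ n)   ≡⟨ *-assoc (fromℕ 2) (fromℕ 2 ⁻¹) (2⁻^ n) ⟨
  1ℚ * 2⁻^ n                       ≡⟨ *-identityˡ (2⁻^ n) ⟩
  2⁻^ n                            ∎
  where open ≡-Reasoning

multiple-2⁻^→0 : ∀ m ε → 0ℚ < ε → ∃[ k ] fromℕ m * 2⁻^ k ≤ ε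
multiple-2⁻^→0 m ε 0<ε = k , ≤-trans
  (*⁻¹-≤ {fromℕ (suc n) ⁻¹} {fromℕ (2 ℕ.^ k)} {fromℕ m} (fromℕ-pos (1≤2^ k)) (begin
    fromℕ m
      ≤⟨ ≤-*⁻¹ {fromℕ m} {fromℕ (suc n)} {fromℕ (2 ℕ.^ k)} (fromℕ-pos {suc n} (s≤s z≤n)) (begin
      fromℕ m * fromℕ (suc n)                  ≡⟨ fromℕ-* m (suc n) ⟨
      fromℕ k                                  ≤⟨ fromℕ-mono-≤ (ℕ.<⇒≤ (n<2^n k)) ⟩
      fromℕ (2 ℕ.^ k)                          ∎) ⟩
    fromℕ (2 ℕ.^ k) * fromℕ (suc n) ⁻¹       ≡⟨ *-comm (fromℕ (2 ℕ.^ k)) (fromℕ (suc n) ⁻¹) ⟩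
    fromℕ (suc n) ⁻¹ * fromℕ (2 ℕ.^ k)       ∎))
  (≤-trans (≤-reflexive (sym (1/suc≡fromℕ⁻¹ n))) (proj₂ (archimedean 0<ε)))
  where
  open ≤-Reasoning
  n = proj₁ (archimedean 0<ε)
  k = m ℕ.* suc n

summable-2⁻^ : ∀ {P : ℕ → Set} → Summable P 2⁻^
summable-2⁻^ = summable-ℕ (λ k → k) (λ k → fromℕ 2 * 2⁻^ k) 2⁻^-nonNeg
  (λ k → *-nonNeg (fromℕ-nonNeg 2) (2⁻^-nonNeg k)) (λ _ → ℕ.≤-refl)
  (λ k → ≤-reflexive (begin
    2⁻^ k + sum 2⁻^ (downFrom k) + fromℕ 2 * 2⁻^ (suc k)
      ≡⟨ cong (2⁻^ k + sum 2⁻^ (downFrom k) +_) (2*2⁻^suc k) ⟩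
    2⁻^ k + sum 2⁻^ (downFrom k) + 2⁻^ k
      ≡⟨ solve 2 (λ x s → x :+ s :+ x := s :+ con (fromℕ 2) :* x)
           refl (2⁻^ k) (sum 2⁻^ (downFrom k)) ⟩
    sum 2⁻^ (downFrom k) + fromℕ 2 * 2⁻^ k                ∎))
  (multiple-2⁻^→0 2)
  where
  open ≡-Reasoning
  open +-*-Solver

Smooth : ℕ → ℕ → Set
Smooth k n = 1 ℕ.≤ n × (∀ p → Prime p → p ∣ n → p ℕ.< k)

reciprocal : ℕ → ℚ
reciprocal n = fromℕ n ⁻¹

reciprocal-nonNeg : NonNeg reciprocal
reciprocal-nonNeg = fromℕ⁻¹-nonNeg

summable-smooth : ∀ k → Summable (Smooth (2 ℕ.+ k)) reciprocal
summable-smooth zero ε 0<ε = 1 ∷ [] , bound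
  where
  bound : ∀ {ns} → FiniteSubset (Smooth 2) ns → (∀ {n} → n ∈ ns → n ∉ 1 ∷ []) → sum reciprocal ns ≤ ε
  bound {[]}     _   _ = <⇒≤ 0<ε
  bound {n ∷ ns} fin avoids =
    let 1≤n , smooth = All.head (members fin)
    in contradiction
         (here (no-prime-divisor⇒≡1 1≤n λ p prime-p p∣n →
           ℕ.<⇒≱ (smooth p prime-p p∣n) (ℕ.nonTrivial⇒n>1 p {{prime⇒nonTrivial prime-p}})))
         (avoids (here refl))
summable-smooth (suc k) = summable-along ψ split
  (summable-⊗ ℕ._≟_ ℕ._≟_ {P = U} 2⁻^-nonNeg reciprocal-nonNeg summable-2⁻^ (summable-smooth k))
  where
  q = 2 ℕ.+ k

  ψ : ℕ × ℕ → ℕ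
  ψ (e , m) = q ℕ.^ e ℕ.* m

  split : ∀ n → Smooth (suc q) n →
          ∃[ em ] (U ⟨×⟩ Smooth q) em × ψ em ≡ n × reciprocal n ≤ (2⁻^ ⊗ reciprocal) em
  split n (1≤n , smooth) with e , m , refl , q∤m ← extract-power q (s≤s (s≤s z≤n)) n 1≤n =
    (e , m) , (tt , 1≤m , smooth′) , refl , (begin
      fromℕ (q ℕ.^ e ℕ.* m) ⁻¹      ≡⟨ fromℕ⁻¹-* (ℕ.m^n>0 q e) 1≤m ⟩
      fromℕ (q ℕ.^ e) ⁻¹ * fromℕ m ⁻¹
        ≤⟨ *-monoʳ-≤ (reciprocal-nonNeg m) (fromℕ⁻¹-anti-≤ (1≤2^ e) (ℕ.^-monoˡ-≤ e (s≤s (s≤s z≤n)))) ⟩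
      2⁻^ e * fromℕ m ⁻¹            ∎)
    where
    open ≤-Reasoning
    1≤m : 1 ℕ.≤ m
    1≤m = ∣-pos 1≤n (ℕ.n∣m*n (q ℕ.^ e))
    smooth′ : ∀ p → Prime p → p ∣ m → p ℕ.< q
    smooth′ p prime-p p∣m = ℕ.≤∧≢⇒< (ℕ.s≤s⁻¹ (smooth p prime-p (ℕ.∣n⇒∣m*n (q ℕ.^ e) p∣m)))
      λ { refl → q∤m p∣m }

-- Euler factors and weights

eulerFactor : ℕ → ℚ
eulerFactor q = (1ℚ - fromℕ 3 * fromℕ q ⁻¹) ⁻¹

eulerFactor-* : ∀ t → eulerFactor (5 ℕ.+ t) * fromℕ (2 ℕ.+ t) ≡ fromℕ (5 ℕ.+ t)
eulerFactor-* t = begin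
  eulerFactor q * fromℕ m
    ≡⟨ cong (_* fromℕ m) (⁻¹-unique (1ℚ - fromℕ 3 * fromℕ q ⁻¹) (fromℕ q * fromℕ m ⁻¹) inverse) ⟩
  fromℕ q * fromℕ m ⁻¹ * fromℕ m
    ≡⟨ solve 3 (λ a b c → a :* b :* c := a :* (c :* b)) refl (fromℕ q) (fromℕ m ⁻¹) (fromℕ m) ⟩
  fromℕ q * (fromℕ m * fromℕ m ⁻¹)  ≡⟨ cong (fromℕ q *_) mm⁻¹ ⟩
  fromℕ q * 1ℚ                      ≡⟨ *-identityʳ (fromℕ q) ⟩
  fromℕ q                           ∎
  where
  open ≡-Reasoning
  open +-*-Solver
  q = 5 ℕ.+ t
  m = 2 ℕ.+ t
  mm⁻¹ : fromℕ m * fromℕ m ⁻¹ ≡ 1ℚ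
  mm⁻¹ = *-⁻¹-pos {fromℕ m} (fromℕ-pos {m} (s≤s z≤n))
  qq⁻¹ : fromℕ q * fromℕ q ⁻¹ ≡ 1ℚ
  qq⁻¹ = *-⁻¹-pos {fromℕ q} (fromℕ-pos {q} (s≤s z≤n))
  inverse : (1ℚ - fromℕ 3 * fromℕ q ⁻¹) * (fromℕ q * fromℕ m ⁻¹) ≡ 1ℚ
  inverse = begin
    (1ℚ - fromℕ 3 * fromℕ q ⁻¹) * (fromℕ q * fromℕ m ⁻¹)
      ≡⟨ solve 4 (λ c a b d → (con 1ℚ :- c :* b) :* (a :* d) := (a :- c :* (a :* b)) :* d)
           refl (fromℕ 3) (fromℕ q) (fromℕ q ⁻¹) (fromℕ m ⁻¹) ⟩
    (fromℕ q - fromℕ 3 * (fromℕ q * fromℕ q ⁻¹)) * fromℕ m ⁻¹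
      ≡⟨ cong₂ (λ x y → (x - fromℕ 3 * y) * fromℕ m ⁻¹) (fromℕ-+ 3 m) qq⁻¹ ⟩
    (fromℕ 3 + fromℕ m - fromℕ 3 * 1ℚ) * fromℕ m ⁻¹
      ≡⟨ solve 3 (λ c a b → (c :+ a :- c :* con 1ℚ) :* b := a :* b) refl (fromℕ 3) (fromℕ m) (fromℕ m ⁻¹) ⟩
    fromℕ m * fromℕ m ⁻¹
      ≡⟨ mm⁻¹ ⟩
    1ℚ ∎

cube : ℚ → ℚ
cube p = p * p * p

cube-* : ∀ p q → cube (p * q) ≡ cube p * cube q
cube-* = solve 2 (λ p q → p :* q :* (p :* q) :* (p :* q) := p :* p :* p :* (q :* q :* q)) refl
  where open +-*-Solver

1≤eulerFactor : ∀ {q} → 5 ℕ.≤ q → 1ℚ ≤ eulerFactor q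
1≤eulerFactor {q} 5≤q with t , refl ← ℕ.m≤n⇒∃[o]m+o≡n 5≤q =
  *-cancelʳ-≤ {1ℚ} {eulerFactor q} {fromℕ (2 ℕ.+ t)} (fromℕ-pos {2 ℕ.+ t} (s≤s z≤n)) (begin
    1ℚ * fromℕ (2 ℕ.+ t)              ≡⟨ *-identityˡ (fromℕ (2 ℕ.+ t)) ⟩
    fromℕ (2 ℕ.+ t)                   ≤⟨ fromℕ-mono-≤ (ℕ.m≤n+m (2 ℕ.+ t) 3) ⟩
    fromℕ (5 ℕ.+ t)                   ≡⟨ eulerFactor-* t ⟨
    eulerFactor q * fromℕ (2 ℕ.+ t)   ∎)
  where open ≤-Reasoning

0≤eulerFactor : ∀ {q} → 5 ℕ.≤ q → 0ℚ ≤ eulerFactor q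
0≤eulerFactor 5≤q = ≤-trans (<⇒≤ (positive⁻¹ 1ℚ)) (1≤eulerFactor 5≤q)

5+t≤[2+t]³ : ∀ t → 5 ℕ.+ t ℕ.≤ (2 ℕ.+ t) ℕ.* (2 ℕ.+ t) ℕ.* (2 ℕ.+ t)
5+t≤[2+t]³ t = ℕ.≤-trans (ℕ.m≤m+n (5 ℕ.+ t) (3 ℕ.+ 11 ℕ.* t ℕ.+ 6 ℕ.* (t ℕ.* t) ℕ.+ t ℕ.* t ℕ.* t))
  (ℕ.≤-reflexive (solve 1 (λ t → con 5 :+ t :+ (con 3 :+ con 11 :* t :+ con 6 :* (t :* t) :+ t :* t :* t)
    := (con 2 :+ t) :* (con 2 :+ t) :* (con 2 :+ t)) refl t))
  where open ℕ.+-*-Solver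

cube-eulerFactor-≤ : ∀ {q} → 5 ℕ.≤ q → cube (eulerFactor q) ≤ fromℕ (q ℕ.* q)
cube-eulerFactor-≤ {q} 5≤q with t , refl ← ℕ.m≤n⇒∃[o]m+o≡n 5≤q =
  *-cancelʳ-≤ {cube (eulerFactor q)} {fromℕ (q ℕ.* q)} {fromℕ m³} (fromℕ-pos {m³} (s≤s z≤n)) (begin
    cube (eulerFactor q) * fromℕ m³
      ≡⟨ cong (cube (eulerFactor q) *_) (trans (fromℕ-* (m ℕ.* m) m) (cong (_* fromℕ m) (fromℕ-* m m))) ⟩
    cube (eulerFactor q) * cube (fromℕ m)     ≡⟨ cube-* (eulerFactor q) (fromℕ m) ⟨
    cube (eulerFactor q * fromℕ m)            ≡⟨ cong cube (eulerFactor-* t) ⟩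
    cube (fromℕ q)                            ≡⟨ cong (_* fromℕ q) (fromℕ-* q q) ⟨
    fromℕ (q ℕ.* q) * fromℕ q                 ≤⟨ *-monoˡ-≤ (fromℕ-nonNeg (q ℕ.* q)) (fromℕ-mono-≤ (5+t≤[2+t]³ t)) ⟩
    fromℕ (q ℕ.* q) * fromℕ m³                ∎)
  where
  open ≤-Reasoning
  m = 2 ℕ.+ t
  m³ = m ℕ.* m ℕ.* m

eulerProduct : List ℕ → ℚ
eulerProduct qs = foldr _*_ 1ℚ (map eulerFactor qs)

1≤eulerProduct : ∀ {qs} → All (5 ℕ.≤_) qs → 1ℚ ≤ eulerProduct qs
1≤eulerProduct []                   = ≤-refl
1≤eulerProduct {q ∷ qs} (5≤q ∷ 5≤qs) = ≤-trans (≤-reflexive (sym (*-identityˡ 1ℚ)))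
  (*-mono-≤ (0≤eulerFactor 5≤q) (<⇒≤ (positive⁻¹ 1ℚ)) (1≤eulerFactor 5≤q) (1≤eulerProduct 5≤qs))

eulerProduct-++ : ∀ ps qs → eulerProduct (ps ++ qs) ≡ eulerProduct ps * eulerProduct qs
eulerProduct-++ []       qs = sym (*-identityˡ (eulerProduct qs))
eulerProduct-++ (p ∷ ps) qs = trans (cong (eulerFactor p *_) (eulerProduct-++ ps qs))
  (sym (*-assoc (eulerFactor p) (eulerProduct ps) (eulerProduct qs)))

0≤eulerProduct : ∀ {qs} → All (5 ℕ.≤_) qs → 0ℚ ≤ eulerProduct qs
0≤eulerProduct 5≤qs = ≤-trans (<⇒≤ (positive⁻¹ 1ℚ)) (1≤eulerProduct 5≤qs)

cube-nonNeg : ∀ {p} → 0ℚ ≤ p → 0ℚ ≤ cube p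
cube-nonNeg 0≤p = *-nonNeg (*-nonNeg 0≤p 0≤p) 0≤p

cube-eulerProduct-≤ : ∀ {qs} → All (5 ℕ.≤_) qs →
                      cube (eulerProduct qs) ≤ fromℕ (product qs ℕ.* product qs)
cube-eulerProduct-≤ [] = ≤-refl
cube-eulerProduct-≤ {q ∷ qs} (5≤q ∷ 5≤qs) = begin
  cube (eulerFactor q * eulerProduct qs)             ≡⟨ cube-* (eulerFactor q) (eulerProduct qs) ⟩
  cube (eulerFactor q) * cube (eulerProduct qs)
    ≤⟨ *-mono-≤ (fromℕ-nonNeg (q ℕ.* q)) (cube-nonNeg (0≤eulerProduct 5≤qs))
         (cube-eulerFactor-≤ 5≤q) (cube-eulerProduct-≤ 5≤qs) ⟩
  fromℕ (q ℕ.* q) * fromℕ (m ℕ.* m)                  ≡⟨ fromℕ-* (q ℕ.* q) (m ℕ.* m) ⟨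
  fromℕ (q ℕ.* q ℕ.* (m ℕ.* m))
    ≡⟨ cong fromℕ (solve 2 (λ q m → q :* q :* (m :* m) := q :* m :* (q :* m)) refl q m) ⟩
  fromℕ (q ℕ.* m ℕ.* (q ℕ.* m))                      ∎
  where
  open ≤-Reasoning
  open ℕ.+-*-Solver
  m = product qs

prime>3⇒≥5 : ∀ {q} → Prime q → 3 ℕ.< q → 5 ℕ.≤ q
prime>3⇒≥5 prime-q 3<q = ℕ.≤∧≢⇒< 3<q λ { refl → composite⇒¬prime composite[4] prime-q }

∈-primeDivisors>3⁻ : ∀ {n q} → q ∈ primeDivisors>3 n → Prime q × q ∣ n × 3 ℕ.< q
∈-primeDivisors>3⁻ {n} q∈ =
  proj₂ (∈-filter⁻ (λ q → prime? q ×-dec (q ∣? n) ×-dec (3 ℕ.<? q)) {xs = upTo (suc n)} q∈)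

∈-primeDivisors>3⁺ : ∀ {n q} → 1 ℕ.≤ n → Prime q → q ∣ n → 3 ℕ.< q → q ∈ primeDivisors>3 n
∈-primeDivisors>3⁺ {n} 1≤n prime-q q∣n 3<q =
  ∈-filter⁺ (λ q → prime? q ×-dec (q ∣? n) ×-dec (3 ℕ.<? q))
    (∈-upTo⁺ (s≤s (ℕ.∣⇒≤ {{ℕ.>-nonZero 1≤n}} q∣n))) (prime-q , q∣n , 3<q)

primeDivisors>3-unique : ∀ n → Unique (primeDivisors>3 n)
primeDivisors>3-unique n = Unique.filter⁺ (λ q → prime? q ×-dec (q ∣? n) ×-dec (3 ℕ.<? q)) (Unique.upTo⁺ (suc n))

primeDivisors>3-≥5 : ∀ n → All (5 ℕ.≤_) (primeDivisors>3 n)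
primeDivisors>3-≥5 n = All.tabulate λ q∈ →
  let prime-q , _ , 3<q = ∈-primeDivisors>3⁻ {n} q∈ in prime>3⇒≥5 prime-q 3<q

weight-nonNeg : NonNeg weight
weight-nonNeg n = 0≤eulerProduct (primeDivisors>3-≥5 n)

weight-≤-* : ∀ {k m n} → 1 ℕ.≤ m → 1 ℕ.≤ n →
  (∀ p → Prime p → p ∣ k → (p ∣ m) ⊎ (p ∣ n)) → weight k ≤ weight m * weight n
weight-≤-* {k} {m} {n} 1≤m 1≤n covers = ≤-trans
  (foldr-mono-⊆ *-1-isCommutativeMonoid {Good = 5 ℕ.≤_} 1≤eulerProduct (λ 5≤q → *-monoˡ-≤ (0≤eulerFactor 5≤q))
    (primeDivisors>3-unique k) ⊆++ (All.++⁺ (primeDivisors>3-≥5 m) (primeDivisors>3-≥5 n)))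
  (≤-reflexive (eulerProduct-++ (primeDivisors>3 m) (primeDivisors>3 n)))
  where
  ⊆++ : primeDivisors>3 k ⊆ primeDivisors>3 m ++ primeDivisors>3 n
  ⊆++ {q} q∈ with prime-q , q∣k , 3<q ← ∈-primeDivisors>3⁻ {k} q∈ with covers q prime-q q∣k
  ... | inj₁ q∣m = ∈-++⁺ˡ (∈-primeDivisors>3⁺ 1≤m prime-q q∣m 3<q)
  ... | inj₂ q∣n = ∈-++⁺ʳ (primeDivisors>3 m) (∈-primeDivisors>3⁺ 1≤n prime-q q∣n 3<q)

cube-weight-≤ : ∀ {n} → 1 ℕ.≤ n → cube (weight n) ≤ fromℕ (n ℕ.* n)
cube-weight-≤ {n} 1≤n = ≤-trans (cube-eulerProduct-≤ (primeDivisors>3-≥5 n))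
  (fromℕ-mono-≤ (ℕ.*-mono-≤ product≤n product≤n))
  where
  product≤n : product (primeDivisors>3 n) ℕ.≤ n
  product≤n = ℕ.∣⇒≤ {{ℕ.>-nonZero 1≤n}} (product-∣ (primeDivisors>3-unique n)
    (All.tabulate (proj₁ ∘ ∈-primeDivisors>3⁻ {n})) (All.tabulate (proj₁ ∘ proj₂ ∘ ∈-primeDivisors>3⁻ {n})))

cube-cancel-≤ : ∀ {p q} → 0ℚ < q → cube p ≤ cube q → p ≤ q
cube-cancel-≤ {p} {q} 0<q p³≤q³ = ≮⇒≥ λ q<p → <⇒≱ (begin-strict
  q * q * q    <⟨ *-monoʳ-<-pos (q * q) {{positive (*-pos 0<q 0<q)}} q<p ⟩
  q * q * p    ≤⟨ *-monoʳ-≤ (<⇒≤ (<-trans 0<q q<p)) (*-mono-≤ (<⇒≤ (<-trans 0<q q<p)) (<⇒≤ 0<q) (<⇒≤ q<p) (<⇒≤ q<p)) ⟩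
  p * p * p    ∎) p³≤q³
  where
  open ≤-Reasoning
  <⇒≱ : ∀ {x y} → x < y → ¬ y ≤ x
  <⇒≱ x<y y≤x = <-irrefl refl (<-≤-trans x<y y≤x)

weight/square : ℕ → ℚ
weight/square n = weight n * fromℕ (n ℕ.* n) ⁻¹

weight/square-nonNeg : NonNeg weight/square
weight/square-nonNeg n = *-nonNeg (weight-nonNeg n) (fromℕ⁻¹-nonNeg (n ℕ.* n))

8^ : ℕ → ℕ
8^ k = 2 ℕ.^ k ℕ.* 2 ℕ.^ k ℕ.* 2 ℕ.^ k

1≤8^ : ∀ k → 1 ℕ.≤ 8^ k
1≤8^ k = ℕ.*-mono-≤ (ℕ.*-mono-≤ (1≤2^ k) (1≤2^ k)) (1≤2^ k)

blockBound : ℕ → ℚ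
blockBound k = fromℕ (4 ℕ.* (2 ℕ.^ k ℕ.* 2 ℕ.^ k)) * (fromℕ (8^ k) ⁻¹ * fromℕ (8^ k) ⁻¹)

-- On [8ᵏ, 8ᵏ⁺¹) the bound weight(n)³ ≤ n² gives weight n ≤ 4·4ᵏ.
weight/square-block : ∀ k {n} → 8^ k ℕ.≤ n → n ℕ.< 8^ (suc k) →
  weight/square n ≤ blockBound k
weight/square-block k {n} 8^k≤n n<8^1+k = *-mono-≤ (fromℕ-nonNeg c) (fromℕ⁻¹-nonNeg (n ℕ.* n))
  (cube-cancel-≤ {weight n} {fromℕ c} (fromℕ-pos 1≤c) (begin
    cube (weight n)              ≤⟨ cube-weight-≤ (ℕ.≤-trans (1≤8^ k) 8^k≤n) ⟩
    fromℕ (n ℕ.* n)              ≤⟨ fromℕ-mono-≤ (ℕ.*-mono-≤ (ℕ.<⇒≤ n<8^1+k) (ℕ.<⇒≤ n<8^1+k)) ⟩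
    fromℕ (8^ (suc k) ℕ.* 8^ (suc k))
      ≡⟨ cong fromℕ (solve 1 (λ x →
           con 2 :* x :* (con 2 :* x) :* (con 2 :* x) :* (con 2 :* x :* (con 2 :* x) :* (con 2 :* x))
           := con 4 :* (x :* x) :* (con 4 :* (x :* x)) :* (con 4 :* (x :* x))) refl x) ⟩
    fromℕ (c ℕ.* c ℕ.* c)        ≡⟨ trans (fromℕ-* (c ℕ.* c) c) (cong (_* fromℕ c) (fromℕ-* c c)) ⟩
    cube (fromℕ c)               ∎))
  (≤-trans (fromℕ⁻¹-anti-≤ (ℕ.*-mono-≤ (1≤8^ k) (1≤8^ k)) (ℕ.*-mono-≤ 8^k≤n 8^k≤n))
    (≤-reflexive (fromℕ⁻¹-* (1≤8^ k) (1≤8^ k))))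
  where
  open ≤-Reasoning
  open ℕ.+-*-Solver
  x = 2 ℕ.^ k
  c = 4 ℕ.* (x ℕ.* x)
  1≤c : 1 ℕ.≤ c
  1≤c = ℕ.*-mono-≤ {1} {4} (s≤s z≤n) (ℕ.*-mono-≤ (1≤2^ k) (1≤2^ k))

8^-suc : ∀ k → 8^ (suc k) ≡ 8^ k ℕ.+ 7 ℕ.* 8^ k
8^-suc k = solve 1 (λ x →
  con 2 :* x :* (con 2 :* x) :* (con 2 :* x) := x :* x :* x :+ con 7 :* (x :* x :* x)) refl (2 ℕ.^ k)
  where open ℕ.+-*-Solver

block-size : ∀ k → fromℕ (7 ℕ.* 8^ k) * blockBound k ≡ fromℕ 28 * 2⁻^ k
block-size k = begin
  fromℕ (7 ℕ.* 8^ k) * (fromℕ (4 ℕ.* (x ℕ.* x)) * (fromℕ (8^ k) ⁻¹ * fromℕ (8^ k) ⁻¹))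
    ≡⟨ cong₂ (λ p q → p * (q * (Z * Z))) (fromℕ-* 7 (8^ k))
         (trans (fromℕ-* 4 (x ℕ.* x)) (cong (fromℕ 4 *_) (fromℕ-* x x))) ⟩
  fromℕ 7 * W * (fromℕ 4 * (X * X) * (Z * Z))
    ≡⟨ solve 5 (λ a b w x z → a :* w :* (b :* (x :* x) :* (z :* z)) := a :* b :* (w :* z) :* (x :* x :* z))
         refl (fromℕ 7) (fromℕ 4) W X Z ⟩
  fromℕ 7 * fromℕ 4 * (W * Z) * (X * X * Z)
    ≡⟨ cong₂ (λ p q → p * q * (X * X * Z)) (sym (fromℕ-* 7 4)) (*-⁻¹-pos {W} (fromℕ-pos (1≤8^ k))) ⟩
  fromℕ 28 * 1ℚ * (X * X * Z)
    ≡⟨ cong₂ (λ p q → p * (X * X * q)) (*-identityʳ (fromℕ 28)) Z≡Y³ ⟩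
  fromℕ 28 * (X * X * (Y * Y * Y))
    ≡⟨ cong (fromℕ 28 *_) (solve 2 (λ x y → x :* x :* (y :* y :* y) := (x :* y) :* (x :* y) :* y) refl X Y) ⟩
  fromℕ 28 * ((X * Y) * (X * Y) * Y)
    ≡⟨ cong (λ p → fromℕ 28 * (p * p * Y)) (*-⁻¹-pos {X} (fromℕ-pos (1≤2^ k))) ⟩
  fromℕ 28 * (1ℚ * 1ℚ * Y)
    ≡⟨ cong (fromℕ 28 *_) (*-identityˡ Y) ⟩
  fromℕ 28 * Y ∎
  where
  open ≡-Reasoning
  open +-*-Solver
  x = 2 ℕ.^ k
  X = fromℕ x
  Y = 2⁻^ k
  W = fromℕ (8^ k)
  Z = fromℕ (8^ k) ⁻¹
  Z≡Y³ : Z ≡ Y * Y * Y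
  Z≡Y³ = trans (fromℕ⁻¹-* (ℕ.*-mono-≤ (1≤2^ k) (1≤2^ k)) (1≤2^ k)) (cong (_* Y) (fromℕ⁻¹-* (1≤2^ k) (1≤2^ k)))

summable-weight/square : ∀ {P : ℕ → Set} → Summable P weight/square
summable-weight/square = summable-ℕ 8^ (λ k → fromℕ 56 * 2⁻^ k) weight/square-nonNeg
  (λ k → *-nonNeg (fromℕ-nonNeg 56) (2⁻^-nonNeg k)) k≤8^k step (multiple-2⁻^→0 56)
  where
  k≤8^k : ∀ k → k ℕ.≤ 8^ k
  k≤8^k k = ℕ.≤-trans (ℕ.<⇒≤ (n<2^n k)) (ℕ.≤-trans (ℕ.≤-reflexive (sym (ℕ.*-identityˡ (2 ℕ.^ k))))
    (ℕ.*-monoˡ-≤ (2 ℕ.^ k) (ℕ.*-mono-≤ (1≤2^ k) (1≤2^ k))))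

  S : ℕ → ℚ
  S n = sum weight/square (downFrom n)

  block : ∀ k → S (8^ (suc k)) ≤ S (8^ k) + fromℕ 28 * 2⁻^ k
  block k = begin
    S (8^ (suc k))                ≡⟨ cong S (8^-suc k) ⟩
    S (8^ k ℕ.+ 7 ℕ.* 8^ k)
      ≤⟨ sum-downFrom-+-≤ {weight/square} {blockBound k} (8^ k) (7 ℕ.* 8^ k)
           (λ n 8^k≤n n< → weight/square-block k 8^k≤n (subst (n ℕ.<_) (sym (8^-suc k)) n<)) ⟩
    S (8^ k) + fromℕ (7 ℕ.* 8^ k) * blockBound k
      ≡⟨ cong (S (8^ k) +_) (block-size k) ⟩
    S (8^ k) + fromℕ 28 * 2⁻^ k   ∎
    where open ≤-Reasoning

  step : ∀ k → S (8^ (suc k)) + fromℕ 56 * 2⁻^ (suc k) ≤ S (8^ k) + fromℕ 56 * 2⁻^ k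
  step k = begin
    S (8^ (suc k)) + fromℕ 56 * 2⁻^ (suc k)
      ≡⟨ cong (S (8^ (suc k)) +_) (trans (cong (_* 2⁻^ (suc k)) (fromℕ-* 28 2))
           (trans (*-assoc (fromℕ 28) (fromℕ 2) (2⁻^ (suc k))) (cong (fromℕ 28 *_) (2*2⁻^suc k)))) ⟩
    S (8^ (suc k)) + fromℕ 28 * 2⁻^ k
      ≤⟨ +-monoˡ-≤ (fromℕ 28 * 2⁻^ k) (block k) ⟩
    S (8^ k) + fromℕ 28 * 2⁻^ k + fromℕ 28 * 2⁻^ k
      ≡⟨ solve 3 (λ s c y → s :+ c :* y :+ c :* y := s :+ (c :+ c) :* y) refl (S (8^ k)) (fromℕ 28) (2⁻^ k) ⟩
    S (8^ k) + (fromℕ 28 + fromℕ 28) * 2⁻^ k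
      ≡⟨ cong (λ c → S (8^ k) + c * 2⁻^ k) (fromℕ-+ 28 28) ⟨
    S (8^ k) + fromℕ 56 * 2⁻^ k ∎
    where
    open ≤-Reasoning
    open +-*-Solver

-- The gcd parametrisation

Triple : Set
Triple = ℕ × ℕ × ℕ

_≟³_ : DecidableEquality Triple
_≟³_ = ≡-dec ℕ._≟_ (≡-dec ℕ._≟_ ℕ._≟_)

_≟ᴵ_ : DecidableEquality Index
_≟ᴵ_ = ≡-dec ℕ._≟_ _≟³_

summable³ : ∀ {P : ℕ → Set} {a : ℕ → ℚ} → NonNeg a → Summable P a → Summable (P ⟨×⟩ P ⟨×⟩ P) (a ⊗ a ⊗ a)
summable³ 0≤a summable = summable-⊗ ℕ._≟_ (≡-dec ℕ._≟_ ℕ._≟_) 0≤a (⊗-nonNeg 0≤a 0≤a)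
  summable (summable-⊗ ℕ._≟_ ℕ._≟_ 0≤a 0≤a summable summable)

⊗³-nonNeg : ∀ {a : ℕ → ℚ} → NonNeg a → NonNeg (a ⊗ a ⊗ a)
⊗³-nonNeg 0≤a = ⊗-nonNeg 0≤a (⊗-nonNeg 0≤a 0≤a)

fromTriples : Triple × Triple → Index
fromTriples ((g , a , b) , (h , c , d)) = a ℕ.* g , b ℕ.* g , c ℕ.* h , d ℕ.* h

gcd-split : ∀ m n → 1 ℕ.≤ m → 1 ℕ.≤ n →
  ∃[ g ] ∃[ a ] ∃[ b ] (1 ℕ.≤ g × 1 ℕ.≤ a × 1 ℕ.≤ b) × a ℕ.* g ≡ m × b ℕ.* g ≡ n × Coprime a b
gcd-split m n 1≤m 1≤n with ℕ.gcd m n in eq | ℕ.gcd[m,n]∣m m n | ℕ.gcd[m,n]∣n m n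
... | g | divides a refl | divides b refl =
  g , a , b , (1≤g , ∣-pos 1≤m (ℕ.m∣m*n g) , ∣-pos 1≤n (ℕ.m∣m*n g)) , refl , refl , coprime
  where
  1≤g : 1 ℕ.≤ g
  1≤g = ∣-pos 1≤m (ℕ.n∣m*n a)
  coprime : Coprime a b
  coprime {d} (d∣a , d∣b) = ℕ.∣1⇒≡1 (ℕ.*-cancelʳ-∣ g {{ℕ.>-nonZero 1≤g}}
    (subst (d ℕ.* g ∣_) (trans eq (sym (ℕ.*-identityˡ g)))
    (ℕ.gcd-greatest (ℕ.*-monoˡ-∣ g d∣a) (ℕ.*-monoˡ-∣ g d∣b))))

prime-∣-square : ∀ m {p} → Prime p → p ∣ m ℕ.* m → p ∣ m
prime-∣-square m prime-p p∣m² with euclidsLemma m m prime-p p∣m²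
... | inj₁ p∣m = p∣m
... | inj₂ p∣m = p∣m

prime∤1 : ∀ {p} → Prime p → ¬ p ∣ 1
prime∤1 prime-p p∣1 with refl ← ℕ.∣1⇒≡1 p∣1 = ¬prime[1] prime-p

coprime-square : ∀ {m n} → 1 ℕ.≤ m → Coprime m n → Coprime (m ℕ.* m) (n ℕ.* n)
coprime-square {m} {n} 1≤m coprime = no-common-prime⇒coprime (ℕ.*-mono-≤ 1≤m 1≤m) λ p prime-p p∣m² p∣n² →
  prime∤1 prime-p (ℕ.∣-reflexive (coprime (prime-∣-square m prime-p p∣m² , prime-∣-square n prime-p p∣n²)))

lcm-∣ : ∀ {g a b k} → Coprime a b → a ℕ.* g ∣ k → b ℕ.* g ∣ k → 1 ℕ.≤ g → a ℕ.* b ℕ.* g ∣ k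
lcm-∣ {g} {a} {b} coprime (divides c refl) bg∣k 1≤g = subst (a ℕ.* b ℕ.* g ∣_) (ℕ.*-assoc c a g)
  (ℕ.*-monoˡ-∣ g (coprime⇒*-∣ coprime (ℕ.n∣m*n c)
    (ℕ.*-cancelʳ-∣ g {{ℕ.>-nonZero 1≤g}} (subst (b ℕ.* g ∣_) (sym (ℕ.*-assoc c a g)) bg∣k))))

module _ (Δ : ℤ) where

  coprimeTo? : Decidable (CoprimeTo Δ)
  coprimeTo? r = ℤ.gcd (ℤ.+ r) Δ ℤ.≟ 1ℤ

  supportedOn-bounded? : ∀ d → Dec (∀ {q} → q ℕ.< suc d → Prime q → q ∣ d → q ∣ ℤ.∣ Δ ∣)
  supportedOn-bounded? d = ℕ.allUpTo? (λ q → prime? q →-dec (q ∣? d) →-dec (q ∣? ℤ.∣ Δ ∣)) (suc d)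

  supportedOn? : Decidable (λ d → 1 ℕ.≤ d × SupportedOn Δ d)
  supportedOn? d with 1 ℕ.≤? d
  ... | no  1≰d = no (1≰d ∘ proj₁)
  ... | yes 1≤d = map′
    (λ bounded → 1≤d , λ q prime-q q∣d → bounded (s≤s (ℕ.∣⇒≤ {{ℕ.>-nonZero 1≤d}} q∣d)) prime-q q∣d)
    (λ supported {q} _ → proj₂ supported q)
    (supportedOn-bounded? d)

  admissible? : Decidable (Admissible Δ)
  admissible? (r₁ , r₂ , d₁ , d₂) =
    ((1 ℕ.≤? r₁) ×-dec coprimeTo? r₁) ×-dec ((1 ℕ.≤? r₂) ×-dec coprimeTo? r₂) ×-dec
    supportedOn? d₁ ×-dec supportedOn? d₂

  coprimeTo⇒∤ : ∀ {r p} → CoprimeTo Δ r → Prime p → p ∣ r → ¬ p ∣ ℤ.∣ Δ ∣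
  coprimeTo⇒∤ {r} {p} gcd≡1 prime-p p∣r p∣Δ = prime∤1 prime-p
    (subst (p ∣_) (ℤ.+-injective gcd≡1) (ℕ.gcd-greatest p∣r p∣Δ))

  supportedOn⇒smooth : Δ ≢ 0ℤ → ∀ {d m} → SupportedOn Δ d → m ∣ d → 1 ℕ.≤ m → Smooth (2 ℕ.+ ℤ.∣ Δ ∣) m
  supportedOn⇒smooth Δ≢0 supported m∣d 1≤m = 1≤m , λ p prime-p p∣m →
    ℕ.m≤n⇒m≤1+n (s≤s (ℕ.∣⇒≤ {{ℕ.≢-nonZero (Δ≢0 ∘ ℤ.∣i∣≡0⇒i≡0)}} (supported p prime-p (ℕ.∣-trans p∣m m∣d))))

prime-∣-*³ : ∀ l m n {p} → Prime p → p ∣ l ℕ.* m ℕ.* n → (p ∣ l) ⊎ (p ∣ m) ⊎ (p ∣ n)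
prime-∣-*³ l m n prime-p p∣lmn with euclidsLemma (l ℕ.* m) n prime-p p∣lmn
... | inj₂ p∣n = inj₂ (inj₂ p∣n)
... | inj₁ p∣lm = Sum.map₂ inj₁ (euclidsLemma l m prime-p p∣lm)

PositiveTriple : Triple → Set
PositiveTriple (g , a , b) = 1 ℕ.≤ g × 1 ℕ.≤ a × 1 ℕ.≤ b

CoprimeTriple : Triple → Set
CoprimeTriple (g , a , b) = PositiveTriple (g , a , b) × Coprime a b

coordinates : ∀ Δ i → Admissible Δ i →
  ∃[ ts ] (CoprimeTriple (proj₁ ts) × CoprimeTriple (proj₂ ts)) × fromTriples ts ≡ i
coordinates Δ (r₁ , r₂ , d₁ , d₂) ((1≤r₁ , _) , (1≤r₂ , _) , (1≤d₁ , _) , (1≤d₂ , _))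
  with g , a , b , pos , refl , refl , coprime ← gcd-split r₁ r₂ 1≤r₁ 1≤r₂
     | h , c , d , pos′ , refl , refl , coprime′ ← gcd-split d₁ d₂ 1≤d₁ 1≤d₂ =
  ((g , a , b) , (h , c , d)) , ((pos , coprime) , (pos′ , coprime′)) , refl

lcmOfTriple : Triple → ℕ
lcmOfTriple (g , a , b) = a ℕ.* b ℕ.* g

squares : Triple → Triple
squares (g , a , b) = g ℕ.* g , a ℕ.* a , b ℕ.* b

squares-positive : ∀ t → PositiveTriple t → PositiveTriple (squares t)
squares-positive _ (1≤g , 1≤a , 1≤b) = ℕ.*-mono-≤ 1≤g 1≤g , ℕ.*-mono-≤ 1≤a 1≤a , ℕ.*-mono-≤ 1≤b 1≤b

1≤lcmOfTriple : ∀ t → PositiveTriple t → 1 ℕ.≤ lcmOfTriple t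
1≤lcmOfTriple _ (1≤g , 1≤a , 1≤b) = ℕ.*-mono-≤ (ℕ.*-mono-≤ 1≤a 1≤b) 1≤g

reciprocal-lcmOfTriple : ∀ t → PositiveTriple t →
  reciprocal (lcmOfTriple t) ≡ (reciprocal ⊗ reciprocal ⊗ reciprocal) t
reciprocal-lcmOfTriple (g , a , b) (1≤g , 1≤a , 1≤b) = begin
  fromℕ (a ℕ.* b ℕ.* g) ⁻¹               ≡⟨ fromℕ⁻¹-* (ℕ.*-mono-≤ 1≤a 1≤b) 1≤g ⟩
  fromℕ (a ℕ.* b) ⁻¹ * fromℕ g ⁻¹        ≡⟨ cong (_* fromℕ g ⁻¹) (fromℕ⁻¹-* 1≤a 1≤b) ⟩
  fromℕ a ⁻¹ * fromℕ b ⁻¹ * fromℕ g ⁻¹   ≡⟨ *-comm (fromℕ a ⁻¹ * fromℕ b ⁻¹) (fromℕ g ⁻¹) ⟩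
  fromℕ g ⁻¹ * (fromℕ a ⁻¹ * fromℕ b ⁻¹) ∎
  where open ≡-Reasoning

weight-triple-≤ : ∀ g a b → PositiveTriple (g , a , b) →
  weight (a ℕ.* g ℕ.* (b ℕ.* g)) ≤ weight g * (weight a * weight b)
weight-triple-≤ g a b (1≤g , 1≤a , 1≤b) = begin
  weight (a ℕ.* g ℕ.* (b ℕ.* g))        ≤⟨ weight-≤-* 1≤g (ℕ.*-mono-≤ 1≤a 1≤b) covers ⟩
  weight g * weight (a ℕ.* b)
    ≤⟨ *-monoˡ-≤ (weight-nonNeg g) (weight-≤-* 1≤a 1≤b λ p → euclidsLemma a b) ⟩
  weight g * (weight a * weight b)      ∎
  where
  open ≤-Reasoning
  covers : ∀ p → Prime p → p ∣ a ℕ.* g ℕ.* (b ℕ.* g) → (p ∣ g) ⊎ (p ∣ a ℕ.* b)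
  covers p prime-p p∣ with euclidsLemma (a ℕ.* g) (b ℕ.* g) prime-p p∣
  ... | inj₁ p∣ag = Sum.swap (Sum.map₁ (ℕ.∣m⇒∣m*n b) (euclidsLemma a g prime-p p∣ag))
  ... | inj₂ p∣bg = Sum.swap (Sum.map₁ (ℕ.∣n⇒∣m*n a) (euclidsLemma b g prime-p p∣bg))

majorant : Triple × Triple → ℚ
majorant = (weight/square ⊗ weight/square ⊗ weight/square) ⊗ (reciprocal ⊗ reciprocal ⊗ reciprocal)

module _ (Δ : ℤ) where

  lcm-lower : ∀ s t → CoprimeTriple s → CoprimeTriple t → Admissible Δ (fromTriples (s , t)) →
    let r₁ , r₂ , d₁ , d₂ = fromTriples (s , t) in
    lcmOfTriple (squares s) ℕ.* lcmOfTriple t ℕ.≤ ℕ.lcm (r₁ ℕ.^ 2 ℕ.* d₁) (r₂ ℕ.^ 2 ℕ.* d₂)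
  lcm-lower s@(g , a , b) t@(h , c , d) (pos@(1≤g , 1≤a , 1≤b) , coprime) (pos′@(1≤h , _) , coprime′)
            ((1≤r₁ , r₁⊥Δ) , (1≤r₂ , r₂⊥Δ) , (1≤d₁ , d₁-supported) , (1≤d₂ , d₂-supported)) =
    ℕ.∣⇒≤ {{ℕ.>-nonZero 1≤L}} (coprime⇒*-∣
      (no-common-prime⇒coprime (1≤lcmOfTriple (squares s) (squares-positive s pos)) no-common)
      (lcm-∣ (coprime-square 1≤a coprime) (square-∣ a m∣L) (square-∣ b n∣L) (ℕ.*-mono-≤ 1≤g 1≤g))
      (lcm-∣ coprime′ (ℕ.∣-trans (ℕ.n∣m*n (r₁ ℕ.^ 2)) m∣L) (ℕ.∣-trans (ℕ.n∣m*n (r₂ ℕ.^ 2)) n∣L) 1≤h))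
    where
    r₁ = a ℕ.* g
    r₂ = b ℕ.* g
    m = r₁ ℕ.^ 2 ℕ.* (c ℕ.* h)
    n = r₂ ℕ.^ 2 ℕ.* (d ℕ.* h)
    L = ℕ.lcm m n
    m∣L : m ∣ L
    m∣L = ℕ.m∣lcm[m,n] m n
    n∣L : n ∣ L
    n∣L = ℕ.n∣lcm[m,n] m n
    1≤L : 1 ℕ.≤ L
    1≤L = ∣-pos
      (ℕ.*-mono-≤ (ℕ.*-mono-≤ (ℕ.m^n>0 r₁ {{ℕ.>-nonZero 1≤r₁}} 2) 1≤d₁)
                  (ℕ.*-mono-≤ (ℕ.m^n>0 r₂ {{ℕ.>-nonZero 1≤r₂}} 2) 1≤d₂))
      (ℕ.lcm-least {m} {n} (ℕ.m∣m*n n) (ℕ.n∣m*n m))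

    square-∣ : ∀ x {y} → (x ℕ.* g) ℕ.^ 2 ℕ.* y ∣ L → x ℕ.* x ℕ.* (g ℕ.* g) ∣ L
    square-∣ x {y} ∣L = ℕ.∣-trans (ℕ.∣-reflexive
      (solve 2 (λ x g → x :* x :* (g :* g) := x :* g :* (x :* g :* con 1)) refl x g))
      (ℕ.∣-trans (ℕ.m∣m*n y) ∣L)
      where open ℕ.+-*-Solver

    ∤Δ : ∀ {p} → Prime p → p ∣ lcmOfTriple (squares s) → ¬ p ∣ ℤ.∣ Δ ∣
    ∤Δ prime-p p∣ with prime-∣-*³ (a ℕ.* a) (b ℕ.* b) (g ℕ.* g) prime-p p∣
    ... | inj₁ p∣a²        = coprimeTo⇒∤ Δ r₁⊥Δ prime-p (ℕ.∣m⇒∣m*n g (prime-∣-square a prime-p p∣a²))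
    ... | inj₂ (inj₁ p∣b²) = coprimeTo⇒∤ Δ r₂⊥Δ prime-p (ℕ.∣m⇒∣m*n g (prime-∣-square b prime-p p∣b²))
    ... | inj₂ (inj₂ p∣g²) = coprimeTo⇒∤ Δ r₁⊥Δ prime-p (ℕ.∣n⇒∣m*n a (prime-∣-square g prime-p p∣g²))

    ∣Δ : ∀ {p} → Prime p → p ∣ lcmOfTriple t → p ∣ ℤ.∣ Δ ∣
    ∣Δ {p} prime-p p∣ with prime-∣-*³ c d h prime-p p∣
    ... | inj₁ p∣c        = d₁-supported p prime-p (ℕ.∣m⇒∣m*n h p∣c)
    ... | inj₂ (inj₁ p∣d) = d₂-supported p prime-p (ℕ.∣m⇒∣m*n h p∣d)
    ... | inj₂ (inj₂ p∣h) = d₁-supported p prime-p (ℕ.∣n⇒∣m*n c p∣h)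

    no-common : ∀ p → Prime p → p ∣ lcmOfTriple (squares s) → ¬ p ∣ lcmOfTriple t
    no-common p prime-p p∣s p∣t = ∤Δ prime-p p∣s (∣Δ prime-p p∣t)

  term-≤ : ∀ ts → CoprimeTriple (proj₁ ts) × CoprimeTriple (proj₂ ts) → Admissible Δ (fromTriples ts) →
           term (fromTriples ts) ≤ majorant ts
  term-≤ (s@(g , a , b) , t@(h , c , d)) (cs , ct) admissible = begin
    weight (r₁ ℕ.* r₂) * reciprocal L
      ≤⟨ *-mono-≤ (*-nonNeg (weight-nonNeg g) (*-nonNeg (weight-nonNeg a) (weight-nonNeg b))) (reciprocal-nonNeg L)
           (weight-triple-≤ g a b (proj₁ cs))
           (≤-trans (fromℕ⁻¹-anti-≤ (ℕ.*-mono-≤ 1≤s² 1≤t) (lcm-lower s t cs ct admissible)) (≤-reflexive recip)) ⟩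
    weight g * (weight a * weight b) * (reciprocal (g ℕ.* g) * (reciprocal (a ℕ.* a) * reciprocal (b ℕ.* b)) * R)
      ≡⟨ solve 7 (λ x y z u v w r → x :* (y :* z) :* (u :* (v :* w) :* r) := x :* u :* (y :* v :* (z :* w)) :* r)
           refl (weight g) (weight a) (weight b)
           (reciprocal (g ℕ.* g)) (reciprocal (a ℕ.* a)) (reciprocal (b ℕ.* b)) R ⟩
    majorant (s , t) ∎
    where
    open ≤-Reasoning
    open +-*-Solver
    r₁ = a ℕ.* g
    r₂ = b ℕ.* g
    L = ℕ.lcm (r₁ ℕ.^ 2 ℕ.* (c ℕ.* h)) (r₂ ℕ.^ 2 ℕ.* (d ℕ.* h))
    R = (reciprocal ⊗ reciprocal ⊗ reciprocal) t
    1≤s² : 1 ℕ.≤ lcmOfTriple (squares s)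
    1≤s² = 1≤lcmOfTriple (squares s) (squares-positive s (proj₁ cs))
    1≤t : 1 ℕ.≤ lcmOfTriple t
    1≤t = 1≤lcmOfTriple t (proj₁ ct)
    recip : reciprocal (lcmOfTriple (squares s) ℕ.* lcmOfTriple t) ≡
            (reciprocal ⊗ reciprocal ⊗ reciprocal) (squares s) * R
    recip = trans (fromℕ⁻¹-* 1≤s² 1≤t) (cong₂ _*_
      (reciprocal-lcmOfTriple (squares s) (squares-positive s (proj₁ cs))) (reciprocal-lcmOfTriple t (proj₁ ct)))

  SmoothTriple : Triple → Set
  SmoothTriple = Smooth (2 ℕ.+ ℤ.∣ Δ ∣) ⟨×⟩ Smooth (2 ℕ.+ ℤ.∣ Δ ∣) ⟨×⟩ Smooth (2 ℕ.+ ℤ.∣ Δ ∣)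

  smooth-triple : Δ ≢ 0ℤ → ∀ ts → CoprimeTriple (proj₂ ts) →
    Admissible Δ (fromTriples ts) → SmoothTriple (proj₂ ts)
  smooth-triple Δ≢0 (_ , (h , c , d)) ((1≤h , 1≤c , 1≤d) , _) (_ , _ , (_ , supported₁) , (_ , supported₂)) =
    supportedOn⇒smooth Δ Δ≢0 supported₁ (ℕ.n∣m*n c) 1≤h ,
    supportedOn⇒smooth Δ Δ≢0 supported₁ (ℕ.m∣m*n h) 1≤c ,
    supportedOn⇒smooth Δ Δ≢0 supported₂ (ℕ.m∣m*n h) 1≤d

  coordinates-≤ : Δ ≢ 0ℤ → ∀ i → Admissible Δ i →
    ∃[ ts ] ((U ⟨×⟩ U ⟨×⟩ U) ⟨×⟩ SmoothTriple) ts × fromTriples ts ≡ i × term i ≤ majorant ts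
  coordinates-≤ Δ≢0 i admissible =
    let ts , coprimes , eq = coordinates Δ i admissible
        admissible′ = subst (Admissible Δ) (sym eq) admissible
    in ts , ((tt , tt , tt) , smooth-triple Δ≢0 ts (proj₂ coprimes) admissible′) , eq ,
       subst (λ j → term j ≤ majorant ts) eq (term-≤ ts coprimes admissible′)

  summable-term : Δ ≢ 0ℤ → Summable (Admissible Δ) term
  summable-term Δ≢0 = summable-along fromTriples (coordinates-≤ Δ≢0)
    (summable-⊗ _≟³_ _≟³_ (⊗³-nonNeg weight/square-nonNeg) (⊗³-nonNeg reciprocal-nonNeg)
      (summable³ weight/square-nonNeg summable-weight/square)
      (summable³ reciprocal-nonNeg (summable-smooth ℤ.∣ Δ ∣)))

term-nonNeg : NonNeg term
term-nonNeg (r₁ , r₂ , d₁ , d₂) =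
  *-nonNeg (weight-nonNeg (r₁ ℕ.* r₂)) (fromℕ⁻¹-nonNeg (ℕ.lcm (r₁ ℕ.^ 2 ℕ.* d₁) (r₂ ℕ.^ 2 ℕ.* d₂)))

lemma4p4 : ∀ (Δ : ℤ) → Δ ≢ 0ℤ →
    Σ[ C ∈ ℚ ] Σ[ S ∈ ℝ ] (HasSum (Admissible Δ) term S × S ≤ᴿ C)
lemma4p4 Δ Δ≢0 = summable⇒hasSum _≟ᴵ_ term-nonNeg (admissible? Δ) (summable-term Δ Δ≢0)
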